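{- Let $\mathit{tw}(n)$ be a function of $n$ and let $\mathcal{G}$ be the family of (connected) graphs of treewidth at most $\mathit{tw}(n)$. Let $\delta_{\mathcal{G}}(n)=\max\{\delta(\mathcal{A}(G)) : G\in\mathcal{G},\ |V(G)|=n\}$. Then $$\Omega(\mathit{tw}(n)\cdot n)\le \delta_{\mathcal{G}}(n)\le O(\mathit{tw}(n)\cdot n\log n).$$
   Context: All graphs are finite, simple and connected. For a graph $G=(V,E)$, a search tree on $G$ is a rooted tree with vertex set $V$ defined recursively: its root is some vertex $r\in V$, and $r$ is joined to the roots of search trees on each connected component of $G-r$. The tubes of a search tree are the vertex sets of its subtrees. Two search trees on $G$ are related by a rotation if their sets of tubes have symmetric difference of size exactly two. The graph associahedron $\mathcal{A}(G)$ is a polytope whose skeleton is isomorphic to the graph on search trees of $G$ with adjacency given by rotations; $\delta(\mathcal{A}(G))$ is the diameter of this graph. Treewidth is the usual graph parameter (one less than the smallest clique number of a chordal supergraph of $G$).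
   Formalization: The formal statement assumes 1 ≤ tw(n) ≤ n−1 for all n ≥ 2: for tw(n)=0 the maximum is over an empty family, and for tw(n)=n² the lower bound is false. Functions violating this only for small n, or with n ≤ tw(n)=O(n), follow by replacing tw(n) with min(max(tw(n),1), n−1). -}

module Defs where

open import Data.Nat using (ℕ; zero; suc; _≤_; _+_)
open import Data.Bool using (Bool; true; false)
open import Data.Fin using (Fin; toℕ)
open import Data.Fin.Subset using (Subset; _∈_; _∉_; _⊆_; _-_; ⊤; Nonempty; ∣_∣)
open import Data.List using (List; []; _∷_; _++_)
open import Data.List.Relation.Unary.All using (All; []; _∷_)
open import Data.List.Relation.Unary.Unique.Propositional using (Unique)
import Data.List.Membership.Propositional as LM
open import Data.Product using (Σ; _×_; _,_; ∃)
open import Data.Sum using (_⊎_)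
open import Relation.Binary.PropositionalEquality using (_≡_; _≢_)
open import Relation.Nullary using (¬_)
open import Function.Bundles using (_⇔_)

record Graph (n : ℕ) : Set where
  field
    adj   : Fin n → Fin n → Bool
    sym   : ∀ u v → adj u v ≡ adj v u
    irref : ∀ u → adj u u ≡ false
open Graph public

Edge : ∀ {n} → Graph n → Fin n → Fin n → Set
Edge G u v = adj G u v ≡ true

data WalkIn {n} (G : Graph n) (S : Subset n) : Fin n → Fin n → Set where
  here : ∀ {u} → u ∈ S → WalkIn G S u u
  step : ∀ {u w v} → u ∈ S → Edge G u w → WalkIn G S w v → WalkIn G S u v

ConnectedIn : ∀ {n} → Graph n → Subset n → Set
ConnectedIn G S = Nonempty S × (∀ u v → u ∈ S → v ∈ S → WalkIn G S u v)

Connected : ∀ {n} → Graph n → Set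
Connected G = ConnectedIn G ⊤

IsComponent : ∀ {n} → Graph n → Subset n → Subset n → Set
IsComponent G S C =
  C ⊆ S × ConnectedIn G C × (∀ u v → u ∈ C → v ∈ S → Edge G u v → v ∈ C)

data SearchTree {n} (G : Graph n) : Subset n → Set where
  node : ∀ {S} (r : Fin n) → r ∈ S →
         (children : List (Subset n)) →
         (∀ C → IsComponent G (S - r) C ⇔ (C LM.∈ children)) →
         Unique children →
         All (SearchTree G) children →
         SearchTree G S

mutual
  tubes : ∀ {n} {G : Graph n} {S} → SearchTree G S → List (Subset n)
  tubes {S = S} (node r _ _ _ _ ts) = S ∷ tubesAll ts

  tubesAll : ∀ {n} {G : Graph n} {cs} → All (SearchTree G) cs → List (Subset n)
  tubesAll []       = []
  tubesAll (t ∷ ts) = tubes t ++ tubesAll ts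

ST : ∀ {n} → Graph n → Set
ST G = SearchTree G ⊤

SameTubes : ∀ {n} {G : Graph n} → ST G → ST G → Set
SameTubes {n} T T' = ∀ (Z : Subset n) → (Z LM.∈ tubes T) ⇔ (Z LM.∈ tubes T')

Rotation : ∀ {n} {G : Graph n} → ST G → ST G → Set
Rotation {n} T T' = Σ (Subset n) λ X → Σ (Subset n) λ Y → X ≢ Y ×
  (∀ (Z : Subset n) →
     (((Z LM.∈ tubes T) × ¬ (Z LM.∈ tubes T')) ⊎ (¬ (Z LM.∈ tubes T) × (Z LM.∈ tubes T')))
     ⇔ (Z ≡ X ⊎ Z ≡ Y))

-- Reach k T T' : there is a path of exactly k rotations from T to T'
-- in the skeleton of the graph associahedron.
data Reach {n} {G : Graph n} : ℕ → ST G → ST G → Set where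
  same : ∀ {T T'} → SameTubes T T' → Reach zero T T'
  rot  : ∀ {k T T₁ T'} → Rotation T T₁ → Reach k T₁ T' → Reach (suc k) T T'

DiamAtMost : ∀ {n} → Graph n → ℕ → Set
DiamAtMost G D = ∀ (T T' : ST G) → Σ ℕ λ k → k ≤ D × Reach k T T'

DiamAtLeast : ∀ {n} → Graph n → ℕ → Set
DiamAtLeast G D = Σ (ST G) λ T → Σ (ST G) λ T' → ∀ k → Reach k T T' → D ≤ k

CycNeighbours : (m : ℕ) → Fin m → Fin m → Set
CycNeighbours m i j =
  toℕ j ≡ suc (toℕ i) ⊎ toℕ i ≡ suc (toℕ j)
  ⊎ (toℕ i ≡ 0 × suc (toℕ j) ≡ m) ⊎ (toℕ j ≡ 0 × suc (toℕ i) ≡ m)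

IsCycle : ∀ {n} → Graph n → (m : ℕ) → (Fin m → Fin n) → Set
IsCycle G m c =
  (∀ i j → c i ≡ c j → i ≡ j) × (∀ i j → CycNeighbours m i j → Edge G (c i) (c j))

Chordal : ∀ {n} → Graph n → Set
Chordal G = ∀ (k : ℕ) (c : Fin (4 + k) → Fin _) → IsCycle G (4 + k) c →
  Σ (Fin (4 + k)) λ i → Σ (Fin (4 + k)) λ j →
    i ≢ j × ¬ CycNeighbours (4 + k) i j × Edge G (c i) (c j)

IsClique : ∀ {n} → Graph n → Subset n → Set
IsClique G S = ∀ u v → u ∈ S → v ∈ S → u ≢ v → Edge G u v

TreewidthAtMost : ∀ {n} → Graph n → ℕ → Set
TreewidthAtMost {n} G k = Σ (Graph n) λ H →
  (∀ u v → Edge G u v → Edge H u v) × Chordal H ×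
  (∀ S → IsClique H S → ∣ S ∣ ≤ suc k)

{-# OPTIONS --safe #-}
-- A linear order σ of the vertices determines a search tree: the tube of v is the component
-- of v among the vertices from v on, and every search tree arises in this way. Swapping two
-- consecutive vertices of σ is a rotation if they lie in a common component of the remaining
-- vertices and leaves the tree unchanged otherwise. Hence σ can be sorted into τ, bringing the
-- vertices of τ to the front one at a time, with at most as many rotations as the sum of the
-- sizes of the tubes of τ.
--
-- Upper bound: a chordal graph has balanced clique separators, and removing them recursively
-- gives an order τ in which each vertex lies in O(tw · log n) tubes; any two trees are joined
-- through τ.
--
-- Lower bound: a rotation changes the ancestor relation of at most one pair of adjacent
-- vertices, so trees that orient h · r edges oppositely are at distance at least h · r. Such
-- trees exist on the join of a clique on h = ⌈tw/2⌉ vertices with r = n − h independent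
-- vertices, whose treewidth is at most h.
module Submission where

open import Defs
open import Data.Nat using (ℕ; zero; suc; _≤_; _<_; _*_; _+_; _^_; z≤n; s≤s; s≤s⁻¹; ⌈_/2⌉; _<?_; _≤?_)
open import Data.Nat.Logarithm using (⌊log₂_⌋; ⌊log₂⌋-mono-≤; ⌊log₂[2^n]⌋≡n)
open import Data.Product using (Σ; ∃; _×_; _,_; proj₁; proj₂; map₁; map₂)
open import Data.Nat.Properties
open import Data.Nat.Solver using (module +-*-Solver)
import Data.Bool as Bool
open import Data.Bool using (Bool; true; false; _∧_; _∨_; not)
open import Data.Bool.Properties using (∨-comm; ∨-zeroʳ)
open import Data.Fin using (Fin; zero; suc; toℕ; _↑ˡ_; _↑ʳ_; splitAt)
import Data.Fin.Properties as Fin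
open import Data.Fin.Properties using (any?; toℕ-injective; toℕ<n)
open import Data.Fin.Subset using (Subset; inside; outside; _∈_; _∉_; _⊆_; _∪_; _─_; _-_; ⁅_⁆; ⊤; ∣_∣)
open import Data.Fin.Subset.Properties
open import Data.List using (List; []; _∷_; _++_; map; filter; length; allFin; cartesianProduct)
open import Data.List.Membership.Propositional using (find; lose) renaming (_∈_ to _∈ₗ_; _∉_ to _∉ₗ_)
import Data.List.Membership.Propositional.Properties as ∈ₗ
open import Data.List.Relation.Unary.All using (All; []; _∷_)
import Data.List.Relation.Unary.All as All
import Data.List.Relation.Unary.All.Properties as Allₚ
open import Data.List.Relation.Unary.Any using (Any; here; there)
import Data.List.Relation.Unary.Any as Any
open import Data.List.Relation.Unary.AllPairs using ([]; _∷_)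
open import Data.List.Relation.Unary.Unique.Propositional using (Unique)
import Data.List.Relation.Unary.Unique.Propositional.Properties as Unique
open import Data.List.Relation.Binary.Permutation.Propositional using (_↭_; ↭-refl; ↭-sym; prep; swap)
open import Data.List.Relation.Binary.Permutation.Propositional.Properties using (∈-resp-↭; drop-mid; shift)
open import Data.List.Relation.Binary.BagAndSetEquality using (∼bag⇒↭)
open import Data.List.Membership.Propositional.Properties.WithK using (unique∧set⇒bag)
open import Data.Sum using (_⊎_; inj₁; inj₂; [_,_]′)
import Data.Sum as Sum
open import Data.Vec using ([]; _∷_; here; there)
import Data.Vec.Properties as Vec
open import Function using (_∘_; id; case_of_)
open import Function.Bundles using (_⇔_; mk⇔; Equivalence)
open import Relation.Binary.PropositionalEquality using (_≡_; _≢_; refl; trans; cong; cong₂; subst) renaming (sym to ≡-sym)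
open import Relation.Binary.Definitions using (tri<; tri≈; tri>)
open import Relation.Nullary using (¬_; Dec; yes; no; contradiction)
open import Relation.Nullary.Decidable using (_×-dec_; ¬?)
import Relation.Nullary.Decidable as Dec
open import Relation.Unary using (Decidable)

open Equivalence using (to; from)

-- Components

-- A predicate in place of a `Subset` also covers vertex sets given by lists; for `P = _∈ S` this
-- unfolds to `IsComponent G S`.
ComponentOf : ∀ {n} → Graph n → (Fin n → Set) → Subset n → Set
ComponentOf G P C =
  (∀ {x} → x ∈ C → P x) × ConnectedIn G C × (∀ u v → u ∈ C → P v → Edge G u v → v ∈ C)

edge-sym : ∀ {n} (G : Graph n) {u v} → Edge G u v → Edge G v u
edge-sym G {u} {v} e = trans (sym G v u) e

module _ {n : ℕ} {G : Graph n} where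

  walk-mono : ∀ {S S′ u v} → S ⊆ S′ → WalkIn G S u v → WalkIn G S′ u v
  walk-mono S⊆S′ (here u∈S)     = here (S⊆S′ u∈S)
  walk-mono S⊆S′ (step u∈S e w) = step (S⊆S′ u∈S) e (walk-mono S⊆S′ w)

  walk-source : ∀ {S u v} → WalkIn G S u v → u ∈ S
  walk-source (here u∈S)     = u∈S
  walk-source (step u∈S _ _) = u∈S

  walk-++ : ∀ {S u v w} → WalkIn G S u v → WalkIn G S v w → WalkIn G S u w
  walk-++ (here _)       q = q
  walk-++ (step u∈S e p) q = step u∈S e (walk-++ p q)

  walk-reverse : ∀ {S u v} → WalkIn G S u v → WalkIn G S v u
  walk-reverse (here u∈S)     = here u∈S
  walk-reverse (step u∈S e p) =
    walk-++ (walk-reverse p) (step (walk-source p) (edge-sym G e) (here u∈S))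

  connected-from : ∀ {S c} → c ∈ S → (∀ {v} → v ∈ S → WalkIn G S c v) → ConnectedIn G S
  connected-from c∈S w = (_ , c∈S) , λ u v u∈S v∈S → walk-++ (walk-reverse (w u∈S)) (w v∈S)

  connected-insert : ∀ {S u w} → ConnectedIn G S → u ∈ S → Edge G u w → ConnectedIn G (S ∪ ⁅ w ⁆)
  connected-insert {S} {u} {w} (_ , walks) u∈S e = connected-from (inS u∈S) λ v∈ →
    case x∈p∪q⁻ S ⁅ w ⁆ v∈ of λ where
      (inj₁ v∈S) → walk-mono inS (walks _ _ u∈S v∈S)
      (inj₂ v∈w) → subst (WalkIn G _ u) (≡-sym (x∈⁅y⁆⇒x≡y w v∈w))
                     (step (inS u∈S) e (here (x∈p∪q⁺ (inj₂ (x∈⁅x⁆ w)))))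
    where
    inS : S ⊆ S ∪ ⁅ w ⁆
    inS = x∈p∪q⁺ ∘ inj₁

  absorb-walk : ∀ {P C D u v} → ComponentOf G P C → (∀ {x} → x ∈ D → P x) →
                WalkIn G D u v → u ∈ C → v ∈ C
  absorb-walk comp D⊆P (here _)     u∈C = u∈C
  absorb-walk comp@(_ , _ , closed) D⊆P (step _ e p) u∈C =
    absorb-walk comp D⊆P p (closed _ _ u∈C (D⊆P (walk-source p)) e)

  -- Maximality of a component, recovered from closure under edges: a walk inside `P` that starts in
  -- `C` cannot leave it.
  absorb : ∀ {P C D u} → ComponentOf G P C → (∀ {x} → x ∈ D → P x) → ConnectedIn G D →
           u ∈ D → u ∈ C → D ⊆ C
  absorb comp D⊆P (_ , walks) u∈D u∈C v∈D = absorb-walk comp D⊆P (walks _ _ u∈D v∈D) u∈C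

  component-unique : ∀ {P C D x} → ComponentOf G P C → ComponentOf G P D → x ∈ C → x ∈ D → C ≡ D
  component-unique c@(C⊆P , conC , _) d@(D⊆P , conD , _) x∈C x∈D =
    ⊆-antisym (absorb d C⊆P conC x∈C x∈D) (absorb c D⊆P conD x∈D x∈C)

  component-resp : ∀ {P Q C} → (∀ {x} → P x → Q x) → (∀ {x} → Q x → P x) →
                   ComponentOf G P C → ComponentOf G Q C
  component-resp P⊆Q Q⊆P (C⊆P , con , closed) =
    P⊆Q ∘ C⊆P , con , λ u v u∈C Qv e → closed u v u∈C (Q⊆P Qv) e

  component-restrict : ∀ {P Q C} → (∀ {x} → Q x → P x) → (∀ {x} → x ∈ C → Q x) →
                       ComponentOf G P C → ComponentOf G Q C
  component-restrict Q⊆P C⊆Q (_ , con , closed) =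
    C⊆Q , con , λ u v u∈C Qv e → closed u v u∈C (Q⊆P Qv) e

module _ {n : ℕ} (G : Graph n) where

  -- The set grown from `v` takes in a neighbouring vertex of `P` as long as there is one; a set
  -- with none left is closed.
  component : ∀ {P} → Decidable P → ∀ {v} → P v → ∃ λ C → ComponentOf G P C × v ∈ C
  component {P} P? {v} Pv =
    grow n ⁅ v ⁆ (≤-reflexive (trans (+-comm 1 n) (cong (n +_) (≡-sym (∣⁅x⁆∣≡1 v)))))
      (λ x∈ → subst P (≡-sym (x∈⁅y⁆⇒x≡y v x∈)) Pv) (x∈⁅x⁆ v)
      (connected-from (x∈⁅x⁆ v) λ x∈ → subst (WalkIn G _ v) (≡-sym (x∈⁅y⁆⇒x≡y v x∈)) (here (x∈⁅x⁆ v)))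
    where
    -- Each round enlarges `X`, so the invariant `n < fuel + ∣ X ∣` is kept, and it rules out
    -- running out of fuel.
    grow : ∀ fuel X → n < fuel + ∣ X ∣ → (∀ {x} → x ∈ X → P x) → v ∈ X → ConnectedIn G X →
           ∃ λ C → ComponentOf G P C × v ∈ C
    grow zero X n<X _ _ _ = contradiction (∣p∣≤n X) (<⇒≱ n<X)
    grow (suc fuel) X n<X X⊆P v∈X con
      with any? (λ u → any? (λ w → u ∈? X ×-dec P? w ×-dec ¬? (w ∈? X) ×-dec (adj G u w Bool.≟ true)))
    ... | yes (u , w , u∈X , Pw , w∉X , e) =
      grow fuel (X ∪ ⁅ w ⁆) (≤-trans n<X (≤-trans (≤-reflexive (≡-sym (+-suc fuel ∣ X ∣))) (+-monoʳ-≤ fuel bigger)))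
        (λ x∈ → [ X⊆P , (λ x∈w → subst P (≡-sym (x∈⁅y⁆⇒x≡y w x∈w)) Pw) ]′ (x∈p∪q⁻ X ⁅ w ⁆ x∈))
        (x∈p∪q⁺ (inj₁ v∈X)) (connected-insert con u∈X e)
      where
      bigger : ∣ X ∣ < ∣ X ∪ ⁅ w ⁆ ∣
      bigger = p⊂q⇒∣p∣<∣q∣ (x∈p∪q⁺ ∘ inj₁ , w , x∈p∪q⁺ (inj₂ (x∈⁅x⁆ w)) , w∉X)
    ... | no none = X , (X⊆P , con , closed) , v∈X
      where
      closed : ∀ u w → u ∈ X → P w → Edge G u w → w ∈ X
      closed u w u∈X Pw e with w ∈? X
      ... | yes w∈X = w∈X
      ... | no  w∉X = contradiction (u , w , u∈X , Pw , w∉X , e) none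

-- Linear orders and search trees

-- `b` is the earliest vertex of `Z` in the order, hence the root of the subtree with tube `Z`.
data Tube {n} (G : Graph n) : List (Fin n) → Fin n → Subset n → Set where
  top   : ∀ {b ys Z} → ComponentOf G (_∈ₗ (b ∷ ys)) Z → b ∈ Z → Tube G (b ∷ ys) b Z
  below : ∀ {v b ys Z} → Tube G ys b Z → Tube G (v ∷ ys) b Z

TubeOf : ∀ {n} → Graph n → List (Fin n) → Subset n → Set
TubeOf G σ Z = ∃ λ b → Tube G σ b Z

_∈ₗ?_ : ∀ {n} (x : Fin n) (σ : List (Fin n)) → Dec (x ∈ₗ σ)
x ∈ₗ? σ = Any.any? (x Fin.≟_) σ

head∉tail : ∀ {A : Set} {x : A} {xs} → Unique (x ∷ xs) → x ∉ₗ xs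
head∉tail = Unique.Unique[x∷xs]⇒x∉xs

unique-tail : ∀ {A : Set} {x : A} {xs} → Unique (x ∷ xs) → Unique xs
unique-tail (_ ∷ u) = u

unique-∷ : ∀ {A : Set} {x : A} {xs} → x ∉ₗ xs → Unique xs → Unique (x ∷ xs)
unique-∷ x∉xs u = Allₚ.¬Any⇒All¬ _ x∉xs ∷ u

x∈p─q⇒x∉q : ∀ {n} {x : Fin n} (p q : Subset n) → x ∈ p ─ q → x ∉ q
x∈p─q⇒x∉q (_ ∷ _) (inside ∷ _)  () here
x∈p─q⇒x∉q (_ ∷ p) (_ ∷ q) (there x∈) (there x∈q) = x∈p─q⇒x∉q p q x∈ x∈q

x∈p-y⇒x≢y : ∀ {n} {x y : Fin n} (p : Subset n) → x ∈ p - y → x ≢ y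
x∈p-y⇒x≢y {y = y} p x∈ refl = x∈p─q⇒x∉q p ⁅ y ⁆ x∈ (x∈⁅x⁆ y)

x∈p-y⇒x∈p : ∀ {n} {x y : Fin n} (p : Subset n) → x ∈ p - y → x ∈ p
x∈p-y⇒x∈p {y = y} p = p─q⊆p p ⁅ y ⁆

Separated : ∀ {n} → Graph n → (P Q : Fin n → Set) → Set
Separated G P Q = ∀ {u v} → P u → Q v → u ≢ v × ¬ Edge G u v

-- Quantifying over the suffix M makes linearisations of separated sets concatenable.
record Linearisation {n} (G : Graph n) (P : Fin n → Set) (𝒯 : Subset n → Set) : Set where
  field
    list      : List (Fin n)
    sound     : ∀ {x} → x ∈ₗ list → P x
    complete  : ∀ {x} → P x → x ∈ₗ list
    unique    : Unique list
    tube⇒     : ∀ M → Separated G P (_∈ₗ M) → ∀ {Z} → TubeOf G (list ++ M) Z → 𝒯 Z ⊎ TubeOf G M Z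
    tube⇐     : ∀ M → Separated G P (_∈ₗ M) → ∀ {Z} → 𝒯 Z ⊎ TubeOf G M Z → TubeOf G (list ++ M) Z

module _ {n : ℕ} {G : Graph n} where

  tube-⊆ : ∀ {σ b Z x} → Tube G σ b Z → x ∈ Z → x ∈ₗ σ
  tube-⊆ (top (Z⊆ , _) _) x∈Z = Z⊆ x∈Z
  tube-⊆ (below t)        x∈Z = there (tube-⊆ t x∈Z)

  tube-root : ∀ {σ b Z} → Tube G σ b Z → b ∈ Z
  tube-root (top _ b∈Z) = b∈Z
  tube-root (below t)   = tube-root t

  tube-connected : ∀ {σ b Z} → Tube G σ b Z → ConnectedIn G Z
  tube-connected (top (_ , con , _) _) = con
  tube-connected (below t)             = tube-connected t

  tube-exists : ∀ {σ b} → b ∈ₗ σ → ∃ λ Z → Tube G σ b Z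
  tube-exists {b ∷ ys} (here refl) with component G (_∈ₗ? (b ∷ ys)) (here refl)
  ... | Z , comp , b∈Z = Z , top comp b∈Z
  tube-exists (there b∈) with tube-exists b∈
  ... | Z , t = Z , below t

  tube-root-unique : ∀ {σ b b′ Z} → Unique σ → Tube G σ b Z → Tube G σ b′ Z → b ≡ b′
  tube-root-unique u (top _ _) (top _ _)     = refl
  tube-root-unique u (top _ b∈Z) (below t)   = contradiction (tube-⊆ t b∈Z) (head∉tail u)
  tube-root-unique u (below t) (top _ b∈Z)   = contradiction (tube-⊆ t b∈Z) (head∉tail u)
  tube-root-unique u (below t) (below t′)    = tube-root-unique (unique-tail u) t t′

  separated-⊆ˡ : ∀ {P P′ Q : Fin n → Set} → (∀ {x} → P′ x → P x) → Separated G P Q → Separated G P′ Q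
  separated-⊆ˡ P′⊆P sep u∈ v∈ = sep (P′⊆P u∈) v∈

  mutual
    -- Preorder: the root comes first, then the subtrees one after another. They lie in distinct
    -- components of `S - r`, so vertices of later subtrees enlarge no tube of an earlier one.
    linearise : ∀ {S} (t : SearchTree G S) → ConnectedIn G S → Linearisation G (_∈ S) (_∈ₗ tubes t)
    linearise {S} (node r r∈S cs iff uniq ts) con = record
      { list     = r ∷ rest.list
      ; sound    = λ where
          (here refl) → r∈S
          (there x∈)  → inS (rest.sound x∈)
      ; complete = complete
      ; unique   = unique-∷ (λ r∈ → ≢r (rest.sound r∈) refl) rest.unique
      ; tube⇒    = λ M sep → λ where
          (_ , top comp r∈Z) → inj₁ (here (component-unique comp (comp-S M sep) r∈Z r∈S))
          (b , below t)      → Sum.map₁ there (rest.tube⇒ M (separated-⊆ˡ inS sep) (b , t))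
      ; tube⇐    = λ M sep → λ where
          (inj₁ (here refl)) → r , top (comp-S M sep) r∈S
          (inj₁ (there Z∈))  → map₂ below (rest.tube⇐ M (separated-⊆ˡ inS sep) (inj₁ Z∈))
          (inj₂ Z∈)          → map₂ below (rest.tube⇐ M (separated-⊆ˡ inS sep) (inj₂ Z∈))
      }
      where
      module rest = Linearisation (linearise-all ts uniq λ C∈ → from (iff _) C∈)
      InChild : Fin n → Set
      InChild x = ∃ λ C → C ∈ₗ cs × x ∈ C
      in- : ∀ {x} → InChild x → x ∈ S - r
      in- (_ , C∈ , x∈C) = proj₁ (from (iff _) C∈) x∈C
      inS : ∀ {x} → InChild x → x ∈ S
      inS = x∈p-y⇒x∈p S ∘ in-
      ≢r : ∀ {x} → InChild x → x ≢ r
      ≢r = x∈p-y⇒x≢y S ∘ in-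
      complete : ∀ {x} → x ∈ S → x ∈ₗ r ∷ rest.list
      complete {x} x∈S with x Fin.≟ r
      ... | yes x≡r = here x≡r
      ... | no  x≢r with component G (_∈? (S - r)) (x∈p∧x≢y⇒x∈p-y x∈S x≢r)
      ...   | C , comp , x∈C = there (rest.complete (C , to (iff C) comp , x∈C))
      comp-S : ∀ M → Separated G (_∈ S) (_∈ₗ M) → ComponentOf G (_∈ₗ r ∷ rest.list ++ M) S
      comp-S M sep = ∈ₗ.∈-++⁺ˡ ∘ complete , con , closed
        where
        closed : ∀ u v → u ∈ S → v ∈ₗ r ∷ rest.list ++ M → Edge G u v → v ∈ S
        closed u v u∈S v∈ e with ∈ₗ.∈-++⁻ (r ∷ rest.list) v∈
        ... | inj₁ (here refl) = r∈S
        ... | inj₁ (there v∈r) = inS (rest.sound v∈r)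
        ... | inj₂ v∈M = contradiction e (proj₂ (sep u∈S v∈M))

    linearise-all : ∀ {P cs} (ts : All (SearchTree G) cs) → Unique cs →
                    (∀ {C} → C ∈ₗ cs → ComponentOf G P C) →
                    Linearisation G (λ x → ∃ λ C → C ∈ₗ cs × x ∈ C) (_∈ₗ tubesAll ts)
    linearise-all [] _ _ = record
      { list = [] ; sound = λ () ; complete = λ () ; unique = []
      ; tube⇒ = λ _ _ → inj₂ ; tube⇐ = λ _ _ → [ (λ ()) , id ]′ }
    linearise-all {cs = C ∷ cs} (t ∷ ts) uniq comps = record
      { list     = head.list ++ rest.list
      ; sound    = [ (λ x∈ → C , here refl , head.sound x∈) , inTail ∘ rest.sound ]′ ∘ ∈ₗ.∈-++⁻ head.list
      ; complete = λ where
          (_ , here refl , x∈C) → ∈ₗ.∈-++⁺ˡ (head.complete x∈C)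
          (D , there D∈ , x∈D)  → ∈ₗ.∈-++⁺ʳ head.list (rest.complete (D , D∈ , x∈D))
      ; unique   = Unique.++⁺ head.unique rest.unique
          λ (x∈ , x∈′) → proj₁ (apart (head.sound x∈) (rest.sound x∈′)) refl
      ; tube⇒    = λ M sep T →
          case head.tube⇒ (rest.list ++ M) (sepᶜ M sep) (subst (λ l → TubeOf G l _) (++-assoc head.list rest.list M) T) of λ where
            (inj₁ Z∈) → inj₁ (∈ₗ.∈-++⁺ˡ Z∈)
            (inj₂ T′) → Sum.map₁ (∈ₗ.∈-++⁺ʳ (tubes t)) (rest.tube⇒ M (separated-⊆ˡ inTail sep) T′)
      ; tube⇐    = λ M sep T → subst (λ l → TubeOf G l _) (≡-sym (++-assoc head.list rest.list M))
          (head.tube⇐ (rest.list ++ M) (sepᶜ M sep)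
            (case T of λ where
              (inj₂ TM) → inj₂ (rest.tube⇐ M (separated-⊆ˡ inTail sep) (inj₂ TM))
              (inj₁ Z∈) → Sum.map₂ (λ Z∈ → rest.tube⇐ M (separated-⊆ˡ inTail sep) (inj₁ Z∈))
                                   (∈ₗ.∈-++⁻ (tubes t) Z∈)))
      }
      where
      module head = Linearisation (linearise t (proj₁ (proj₂ (comps (here refl)))))
      module rest = Linearisation (linearise-all ts (unique-tail uniq) (comps ∘ there))
      open import Data.List.Properties using (++-assoc)
      inTail : ∀ {x} → (∃ λ D → D ∈ₗ cs × x ∈ D) → ∃ λ D → D ∈ₗ C ∷ cs × x ∈ D
      inTail (D , D∈ , x∈D) = D , there D∈ , x∈D
      apart : Separated G (_∈ C) (λ x → ∃ λ D → D ∈ₗ cs × x ∈ D)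
      apart u∈C (D , D∈ , v∈D) =
        (λ where refl → distinct (component-unique C-comp D-comp u∈C v∈D)) ,
        (λ e → distinct (component-unique C-comp D-comp
          (proj₂ (proj₂ C-comp) _ _ u∈C (proj₁ D-comp v∈D) e) v∈D))
        where
        C-comp = comps (here refl)
        D-comp = comps (there D∈)
        distinct : C ≢ D
        distinct refl = head∉tail uniq D∈
      sepᶜ : ∀ M → Separated G (λ x → ∃ λ D → D ∈ₗ C ∷ cs × x ∈ D) (_∈ₗ M) →
             Separated G (_∈ C) (_∈ₗ rest.list ++ M)
      sepᶜ M sep u∈C v∈ with ∈ₗ.∈-++⁻ rest.list v∈
      ... | inj₁ v∈r = apart u∈C (rest.sound v∈r)
      ... | inj₂ v∈M = sep (C , here refl , u∈C) v∈M

-- Search trees built from linear orders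

module _ {n : ℕ} (G : Graph n) where

  components-meeting : ∀ {P} → Decidable P → ∀ L → ∃ λ cs → Unique cs ×
    (∀ {C} → C ∈ₗ cs → ComponentOf G P C) × (∀ {v} → v ∈ₗ L → P v → ∃ λ C → C ∈ₗ cs × v ∈ C)
  components-meeting P? [] = [] , [] , (λ ()) , λ ()
  components-meeting P? (v ∷ L) with components-meeting P? L | P? v
  ... | cs , uniq , comps , meets | no ¬Pv = cs , uniq , comps , λ where
    (here refl) Pv → contradiction Pv ¬Pv
    (there u∈)  Pu → meets u∈ Pu
  ... | cs , uniq , comps , meets | yes Pv with component G P? Pv
  ...   | C , comp , v∈C with Any.any? (Vec.≡-dec Bool._≟_ C) cs
  ...     | yes C∈ = cs , uniq , comps , λ where
    (here refl) _  → C , C∈ , v∈C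
    (there u∈)  Pu → meets u∈ Pu
  ...     | no C∉ = C ∷ cs , unique-∷ C∉ uniq ,
    (λ where
      (here refl) → comp
      (there D∈)  → comps D∈) ,
    λ where
      (here refl) _  → C , here refl , v∈C
      (there u∈)  Pu → case meets u∈ Pu of λ (D , D∈ , u∈D) → D , there D∈ , u∈D

  components : ∀ S → ∃ λ cs → Unique cs × (∀ C → IsComponent G S C ⇔ C ∈ₗ cs)
  components S with components-meeting (_∈? S) (allFin n)
  ... | cs , uniq , comps , meets = cs , uniq , λ C → mk⇔
    (λ comp@(C⊆S , ((x , x∈C) , _) , _) → case meets (∈ₗ.∈-allFin x) (C⊆S x∈C) of λ (D , D∈ , x∈D) →
      subst (_∈ₗ cs) (component-unique (comps D∈) comp x∈D x∈C) D∈)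
    comps

module _ {n : ℕ} {G : Graph n} where

  collect-trees : ∀ {cs} {Q : Subset n → Subset n → Set} →
    All (λ C → Σ (SearchTree G C) λ t → ∀ Z → Z ∈ₗ tubes t ⇔ Q C Z) cs →
    Σ (All (SearchTree G) cs) λ ts → ∀ Z → Z ∈ₗ tubesAll ts ⇔ Any (λ C → Q C Z) cs
  collect-trees [] = [] , λ Z → mk⇔ (λ ()) (λ ())
  collect-trees ((t , spec) ∷ qs) with collect-trees qs
  ... | ts , specs = t ∷ ts , λ Z → mk⇔
    ([ here ∘ to (spec Z) , there ∘ to (specs Z) ]′ ∘ ∈ₗ.∈-++⁻ (tubes t))
    (λ where
      (here q)  → ∈ₗ.∈-++⁺ˡ (from (spec Z) q)
      (there q) → ∈ₗ.∈-++⁺ʳ (tubes t) (from (specs Z) q))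

  -- Leading vertices outside `S` are skipped; the first vertex in `S` becomes the root, and the
  -- recursion enters each component of the rest of `S`.
  tree-of : ∀ σ {S} → Unique σ → ComponentOf G (_∈ₗ σ) S →
            Σ (SearchTree G S) λ t → ∀ Z → Z ∈ₗ tubes t ⇔ (TubeOf G σ Z × Z ⊆ S)
  tree-of [] _ (S⊆ , ((x , x∈S) , _) , _) = case S⊆ x∈S of λ ()
  tree-of (v ∷ ys) {S} uniq comp@(S⊆ , con , closed) with v ∈? S
  ... | no v∉S with tree-of ys (unique-tail uniq) (component-restrict there S⊆ys comp)
    where
    S⊆ys : ∀ {x} → x ∈ S → x ∈ₗ ys
    S⊆ys x∈S with S⊆ x∈S
    ... | here refl = contradiction x∈S v∉S
    ... | there x∈  = x∈
  ...   | t , spec = t , λ Z → mk⇔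
    (map₁ (map₂ below) ∘ to (spec Z))
    (λ where
      ((_ , top _ v∈Z) , Z⊆S) → contradiction (Z⊆S v∈Z) v∉S
      ((b , below T) , Z⊆S)   → from (spec Z) ((b , T) , λ {x} → Z⊆S {x}))
  tree-of (v ∷ ys) {S} uniq comp@(S⊆ , con , closed) | yes v∈S with components G (S - v)
  ... | cs , cs-unique , cs-spec = node v v∈S cs cs-spec cs-unique ts , λ Z → mk⇔ ⇒ ⇐
    where
    in-ys : ∀ {x} → x ∈ S - v → x ∈ₗ ys
    in-ys x∈ with S⊆ (x∈p-y⇒x∈p S x∈)
    ... | here x≡v = contradiction x≡v (x∈p-y⇒x≢y S x∈)
    ... | there p  = p
    in-S-v : ∀ {x} → x ∈ S → x ∈ₗ ys → x ∈ S - v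
    in-S-v x∈S x∈ys = x∈p∧x≢y⇒x∈p-y x∈S λ where refl → head∉tail uniq x∈ys
    -- Closure has to hold within all of `ys`, not only within `S - v`: an edge from the child to a
    -- vertex of `ys` stays in `S`, since `S` is itself a component.
    child-comp : ∀ {C} → IsComponent G (S - v) C → ComponentOf G (_∈ₗ ys) C
    child-comp (C⊆ , con , cl) = in-ys ∘ C⊆ , con , λ u w u∈C w∈ys e →
      cl u w u∈C (in-S-v (closed u w (x∈p-y⇒x∈p S (C⊆ u∈C)) (there w∈ys) e) w∈ys) e
    subtrees = collect-trees {cs = cs} {Q = λ C Z → TubeOf G ys Z × Z ⊆ C}
      (All.tabulate λ C∈ → tree-of ys (unique-tail uniq) (child-comp (from (cs-spec _) C∈)))
    ts = proj₁ subtrees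
    ⇒ : ∀ {Z} → Z ∈ₗ S ∷ tubesAll ts → TubeOf G (v ∷ ys) Z × Z ⊆ S
    ⇒ (here refl) = (v , top comp v∈S) , id
    ⇒ {Z} (there Z∈) with find (to (proj₂ subtrees Z) Z∈)
    ... | C , C∈ , (b , T) , Z⊆C = (b , below T) , x∈p-y⇒x∈p S ∘ proj₁ (from (cs-spec C) C∈) ∘ Z⊆C
    ⇐ : ∀ {Z} → TubeOf G (v ∷ ys) Z × Z ⊆ S → Z ∈ₗ S ∷ tubesAll ts
    ⇐ ((_ , top comp′ v∈Z) , _) = here (component-unique comp′ comp v∈Z v∈S)
    ⇐ {Z} ((b , below T) , Z⊆S) with component G (_∈? (S - v)) (in-S-v (Z⊆S (tube-root T)) (tube-⊆ T (tube-root T)))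
    ... | C , C-comp , b∈C = there (from (proj₂ subtrees Z) (Any.map
      (λ where refl → (b , T) , λ {_} → absorb (child-comp C-comp) (tube-⊆ T) (tube-connected T) (tube-root T) b∈C)
      (to (cs-spec C) C-comp)))

-- Moving between linear orders

record Exchange {n} (G : Graph n) (σ σ′ : List (Fin n)) : Set where
  field
    {X Y} : Subset n
    X∈σ   : TubeOf G σ X
    X∉σ′  : ¬ TubeOf G σ′ X
    Y∈σ′  : TubeOf G σ′ Y
    Y∉σ   : ¬ TubeOf G σ Y
    ⇒     : ∀ {Z} → TubeOf G σ Z → Z ≡ X ⊎ TubeOf G σ′ Z
    ⇐     : ∀ {Z} → TubeOf G σ′ Z → Z ≡ Y ⊎ TubeOf G σ Z

-- The index counts only `exch`; a `free` step changes the order but not the set of tubes, hence not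
-- the tree.
data Swaps {n} (G : Graph n) : ℕ → List (Fin n) → List (Fin n) → Set where
  done : ∀ {σ} → Swaps G 0 σ σ
  free : ∀ {k σ σ′ τ} → σ ↭ σ′ → (∀ {Z} → TubeOf G σ Z → TubeOf G σ′ Z) →
         (∀ {Z} → TubeOf G σ′ Z → TubeOf G σ Z) → Swaps G k σ′ τ → Swaps G k σ τ
  exch : ∀ {k σ σ′ τ} → σ ↭ σ′ → Exchange G σ σ′ → Swaps G k σ′ τ → Swaps G (suc k) σ τ

-- The summands are upper bounds on tube sizes, not the sizes themselves, so that estimates made in
-- a larger vertex set or a supergraph carry over.
data Cost {n} (G : Graph n) : List (Fin n) → ℕ → Set where
  []  : Cost G [] 0
  _∷_ : ∀ {v ys a b} → (∀ {C} → ComponentOf G (_∈ₗ v ∷ ys) C → v ∈ C → ∣ C ∣ ≤ a) →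
        Cost G ys b → Cost G (v ∷ ys) (a + b)

unique-resp-↭ : ∀ {A : Set} {xs ys : List A} → xs ↭ ys → Unique xs → Unique ys
unique-resp-↭ p = Unique-resp-↭ (setoid _) (↭⇒↭ₛ p)
  where
  open import Data.List.Relation.Binary.Permutation.Setoid.Properties using (Unique-resp-↭)
  open import Data.List.Relation.Binary.Permutation.Propositional using (↭⇒↭ₛ)
  open import Relation.Binary.PropositionalEquality using (setoid)

length≤∣∣ : ∀ {n} {L : List (Fin n)} {C} → Unique L → (∀ {x} → x ∈ₗ L → x ∈ C) → length L ≤ ∣ C ∣
length≤∣∣ [] _ = z≤n
length≤∣∣ {L = x ∷ L} {C} uniq L⊆C = ≤-trans
  (s≤s (length≤∣∣ {C = C - x} (unique-tail uniq) λ y∈ → x∈p∧x≢y⇒x∈p-y (L⊆C (there y∈)) λ where refl → head∉tail uniq y∈))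
  (x∈p⇒∣p-x∣<∣p∣ (L⊆C (here refl)))

module _ {n : ℕ} {G : Graph n} where

  tubeOf-∷ : ∀ {x σ σ′} → σ ↭ σ′ → (∀ {Z} → TubeOf G σ Z → TubeOf G σ′ Z) →
             ∀ {Z} → TubeOf G (x ∷ σ) Z → TubeOf G (x ∷ σ′) Z
  tubeOf-∷ p σ⇒σ′ (b , top comp b∈Z) =
    b , top (component-resp (∈-resp-↭ (prep _ p)) (∈-resp-↭ (↭-sym (prep _ p))) comp) b∈Z
  tubeOf-∷ p σ⇒σ′ (b , below t) = map₂ below (σ⇒σ′ (b , t))

  tubeOf-∷⁻ : ∀ {x σ Z} → x ∉ Z → TubeOf G (x ∷ σ) Z → TubeOf G σ Z
  tubeOf-∷⁻ x∉Z (_ , top _ x∈Z) = contradiction x∈Z x∉Z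
  tubeOf-∷⁻ x∉Z (b , below t)   = b , t

  -- The tube of `x` is the same over both orders, because they have the same vertices; `X` and `Y`
  -- avoid `x`, so neither of them is that tube.
  exchange-∷ : ∀ {x σ σ′} → x ∉ₗ σ → σ ↭ σ′ → Exchange G σ σ′ → Exchange G (x ∷ σ) (x ∷ σ′)
  exchange-∷ {x} {σ} {σ′} x∉σ p E = record
    { X∈σ  = map₂ below E.X∈σ
    ; X∉σ′ = E.X∉σ′ ∘ tubeOf-∷⁻ (x∉σ ∘ tube-⊆ (proj₂ E.X∈σ))
    ; Y∈σ′ = map₂ below E.Y∈σ′
    ; Y∉σ  = E.Y∉σ ∘ tubeOf-∷⁻ (x∉σ ∘ ∈-resp-↭ (↭-sym p) ∘ tube-⊆ (proj₂ E.Y∈σ′))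
    ; ⇒    = extend p E.⇒
    ; ⇐    = extend (↭-sym p) E.⇐
    }
    where
    module E = Exchange E
    extend : ∀ {ρ ρ′ W} → ρ ↭ ρ′ → (∀ {Z} → TubeOf G ρ Z → Z ≡ W ⊎ TubeOf G ρ′ Z) →
             ∀ {Z} → TubeOf G (x ∷ ρ) Z → Z ≡ W ⊎ TubeOf G (x ∷ ρ′) Z
    extend p f (b , top comp b∈Z) =
      inj₂ (b , top (component-resp (∈-resp-↭ (prep _ p)) (∈-resp-↭ (↭-sym (prep _ p))) comp) b∈Z)
    extend p f (b , below t) = Sum.map₂ (map₂ below) (f (b , t))

  swaps-∷ : ∀ {x k σ τ} → x ∉ₗ σ → Swaps G k σ τ → Swaps G k (x ∷ σ) (x ∷ τ)
  swaps-∷ x∉σ done           = done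
  swaps-∷ x∉σ (free p f g s) =
    free (prep _ p) (tubeOf-∷ p f) (tubeOf-∷ (↭-sym p) g) (swaps-∷ (x∉σ ∘ ∈-resp-↭ (↭-sym p)) s)
  swaps-∷ x∉σ (exch p E s)   =
    exch (prep _ p) (exchange-∷ x∉σ p E) (swaps-∷ (x∉σ ∘ ∈-resp-↭ (↭-sym p)) s)

  swaps-++ : ∀ {k l ρ σ τ} → Swaps G k ρ σ → Swaps G l σ τ → Swaps G (k + l) ρ τ
  swaps-++ done           s′ = s′
  swaps-++ (free p f g s) s′ = free p f g (swaps-++ s s′)
  swaps-++ (exch p E s)   s′ = exch p E (swaps-++ s s′)

  exchange-sym : ∀ {σ σ′} → Exchange G σ σ′ → Exchange G σ′ σ
  exchange-sym E = record
    { X∈σ = E.Y∈σ′ ; X∉σ′ = E.Y∉σ ; Y∈σ′ = E.X∈σ ; Y∉σ = E.X∉σ′ ; ⇒ = E.⇐ ; ⇐ = E.⇒ }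
    where module E = Exchange E

  swaps-sym : ∀ {k σ τ} → Swaps G k σ τ → Swaps G k τ σ
  swaps-sym done = done
  swaps-sym {k} {σ} {τ} (free p f g s) =
    subst (λ l → Swaps G l τ σ) (+-identityʳ k) (swaps-++ (swaps-sym s) (free (↭-sym p) g f done))
  swaps-sym {suc k} {σ} {τ} (exch p E s) =
    subst (λ l → Swaps G l τ σ) (+-comm k 1) (swaps-++ (swaps-sym s) (exch (↭-sym p) (exchange-sym E) done))

  component-swap : ∀ {u v ys C} → ComponentOf G (_∈ₗ u ∷ v ∷ ys) C → ComponentOf G (_∈ₗ v ∷ u ∷ ys) C
  component-swap = component-resp (∈-resp-↭ (swap _ _ ↭-refl)) (∈-resp-↭ (swap _ _ ↭-refl))

  module _ {u v : Fin n} {ys C} (uniq : Unique (u ∷ v ∷ ys))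
           (C-comp : ComponentOf G (_∈ₗ u ∷ v ∷ ys) C) (u∈C : u ∈ C) (v∈C : v ∈ C) where

    -- `X` contains `v` but not `u`, whereas after the swap the tube of `v` is all of `C` and no
    -- later tube contains `v`.
    removed-tube : ∃ λ X → TubeOf G (u ∷ v ∷ ys) X × ¬ TubeOf G (v ∷ u ∷ ys) X ×
                   (∀ {Z} → TubeOf G (u ∷ v ∷ ys) Z → Z ≡ X ⊎ TubeOf G (v ∷ u ∷ ys) Z)
    removed-tube with component G (_∈ₗ? (v ∷ ys)) (here refl)
    ... | X , X-comp , v∈X = X , (v , below (top X-comp v∈X)) , gone , kept
      where
      u∉X : u ∉ X
      u∉X = head∉tail uniq ∘ proj₁ X-comp
      gone : ¬ TubeOf G (v ∷ u ∷ ys) X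
      gone (_ , top comp _) = u∉X (subst (u ∈_) (component-unique (component-swap C-comp) comp v∈C v∈X) u∈C)
      gone (_ , below (top _ u∈X)) = u∉X u∈X
      gone (_ , below (below t))   = head∉tail (unique-tail uniq) (tube-⊆ t v∈X)
      kept : ∀ {Z} → TubeOf G (u ∷ v ∷ ys) Z → Z ≡ X ⊎ TubeOf G (v ∷ u ∷ ys) Z
      kept (_ , top comp u∈Z) =
        inj₂ (v , top (component-swap comp) (subst (v ∈_) (component-unique C-comp comp u∈C u∈Z) v∈C))
      kept (_ , below (top comp v∈Z)) = inj₁ (component-unique comp X-comp v∈Z v∈X)
      kept (_ , below (below t))      = inj₂ (_ , below (below t))

  -- The tube gained is the one that the reverse swap removes.
  exchange-swap : ∀ {u v ys C} → Unique (u ∷ v ∷ ys) → ComponentOf G (_∈ₗ u ∷ v ∷ ys) C →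
                  u ∈ C → v ∈ C → Exchange G (u ∷ v ∷ ys) (v ∷ u ∷ ys)
  exchange-swap uniq comp u∈C v∈C
    with removed-tube uniq comp u∈C v∈C
       | removed-tube (unique-resp-↭ (swap _ _ ↭-refl) uniq) (component-swap comp) v∈C u∈C
  ... | _ , X∈ , X∉ , ⇒ | _ , Y∈ , Y∉ , ⇐ =
    record { X∈σ = X∈ ; X∉σ′ = X∉ ; Y∈σ′ = Y∈ ; Y∉σ = Y∉ ; ⇒ = ⇒ ; ⇐ = ⇐ }

  -- If no component contains both `u` and `v`, deleting one of them leaves the component of the
  -- other as it was.
  tubes-swap : ∀ {u v ys} → (∀ {C} → ComponentOf G (_∈ₗ u ∷ v ∷ ys) C → u ∈ C → v ∉ C) →
               ∀ {Z} → TubeOf G (u ∷ v ∷ ys) Z → TubeOf G (v ∷ u ∷ ys) Z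
  tubes-swap {u} {v} {ys} apart (_ , top comp u∈Z) =
    u , below (top (component-restrict (∈-resp-↭ (swap _ _ ↭-refl) ∘ there) Z⊆ comp) u∈Z)
    where
    Z⊆ : ∀ {x} → x ∈ _ → x ∈ₗ u ∷ ys
    Z⊆ x∈Z with proj₁ comp x∈Z
    ... | here refl         = here refl
    ... | there (here refl) = contradiction x∈Z (apart comp u∈Z)
    ... | there (there x∈)  = there x∈
  tubes-swap {u} {v} {ys} apart {Z} (_ , below (top (Z⊆ , con , closed) v∈Z)) =
    v , top (∈-resp-↭ (swap _ _ ↭-refl) ∘ there ∘ Z⊆ , con , closed′) v∈Z
    where
    closed′ : ∀ w x → w ∈ Z → x ∈ₗ v ∷ u ∷ ys → Edge G w x → x ∈ Z
    closed′ w x w∈Z (here refl)         e = closed w x w∈Z (here refl) e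
    closed′ w x w∈Z (there (there x∈))  e = closed w x w∈Z (there x∈) e
    -- The new vertex is `u`: an edge from `Z` to it would pull all of `Z`, with `v`, into the
    -- component of `u`.
    closed′ w x w∈Z (there (here refl)) e with component G (_∈ₗ? (u ∷ v ∷ ys)) (here refl)
    ... | C , comp , u∈C = contradiction
      (absorb comp (there ∘ Z⊆) con w∈Z (proj₂ (proj₂ comp) u w u∈C (there (Z⊆ w∈Z)) (edge-sym G e)) v∈Z)
      (apart comp u∈C)
  tubes-swap apart (_ , below (below t)) = _ , below (below t)

  -- `v` passes the vertices of `as` from right to left. Passing `a` is paid for only if `a` and `v`
  -- share a component of what remains, and then `a` lies in `C`. The bound on connected sets
  -- through `v` is inherited by the tail.
  bubble : ∀ as {v bs} {C : Subset n} → Unique (as ++ v ∷ bs) →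
           (∀ {D} → ConnectedIn G D → v ∈ D → (∀ {x} → x ∈ D → x ∈ₗ as ++ v ∷ bs) → ∀ {x} → x ∈ D → x ∈ C) →
           ∃ λ k → k ≤ length (filter (_∈? C) as) × Swaps G k (as ++ v ∷ bs) (v ∷ as ++ bs)
  bubble [] _ _ = 0 , z≤n , done
  bubble (a ∷ as) {v} {bs} {C} uniq bound
    with bubble as (unique-tail uniq) (λ con v∈D D⊆ → bound con v∈D (there ∘ D⊆))
       | component G (_∈ₗ? (a ∷ v ∷ as ++ bs)) (here refl)
  ... | k , k≤ , s | D , D-comp@(D⊆ , con , _) , a∈D with v ∈? D
  ...   | no v∉D = k , ≤-trans k≤ (filter-mono a as) ,
    subst (λ l → Swaps G l (a ∷ as ++ v ∷ bs) (v ∷ a ∷ as ++ bs)) (+-identityʳ k) (swaps-++ (swaps-∷ (head∉tail uniq) s)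
      (free (swap _ _ ↭-refl) (tubes-swap apart)
        (tubes-swap λ comp v∈C a∈C → apart (component-swap comp) a∈C v∈C) done))
    where
    apart : ∀ {C} → ComponentOf G (_∈ₗ a ∷ v ∷ as ++ bs) C → a ∈ C → v ∉ C
    apart comp a∈C v∈C = v∉D (subst (v ∈_) (component-unique comp D-comp a∈C a∈D) v∈C)
    filter-mono : ∀ a as → length (filter (_∈? C) as) ≤ length (filter (_∈? C) (a ∷ as))
    filter-mono a as with a ∈? C
    ... | yes _ = n≤1+n _
    ... | no  _ = ≤-refl
  ...   | yes v∈D = suc k , ≤-trans (s≤s k≤) (≤-reflexive (≡-sym (cong length (filter-accept (_∈? C) a∈C)))) ,
    subst (λ l → Swaps G l (a ∷ as ++ v ∷ bs) (v ∷ a ∷ as ++ bs)) (+-comm k 1) (swaps-++ (swaps-∷ (head∉tail uniq) s)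
      (exch (swap _ _ ↭-refl) (exchange-swap (unique-resp-↭ (prep a (shift v as bs)) uniq) D-comp a∈D v∈D) done))
    where
    open import Data.List.Properties using (filter-accept)
    a∈C : a ∈ C
    a∈C = bound con v∈D (∈-resp-↭ (↭-sym (prep a (shift v as bs))) ∘ D⊆) a∈D

  -- Let `C` be the tube in `τ` of the first vertex `v` of `τ`. Moving `v` to the front of `σ` costs
  -- at most the number of vertices of `C` that precede it there, hence at most `∣ C ∣`.
  sort : ∀ {τ c σ} → Cost G τ c → Unique σ → σ ↭ τ → ∃ λ k → k ≤ c × Swaps G k σ τ
  sort [] uniq p with ↭-empty-inv p
    where open import Data.List.Relation.Binary.Permutation.Propositional.Properties using (↭-empty-inv)
  ... | refl = 0 , z≤n , done
  sort {v ∷ ys} (size≤ ∷ cost) uniq p with ∈ₗ.∈-∃++ (∈-resp-↭ (↭-sym p) (here refl))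
  ... | as , bs , refl with component G (_∈ₗ? (v ∷ ys)) (here refl)
  ...   | C , comp , v∈C
    with bubble as {C = C} uniq (λ con v∈D D⊆ → absorb comp (∈-resp-↭ p ∘ D⊆) con v∈D v∈C)
       | sort cost (unique-tail (unique-resp-↭ (shift v as bs) uniq)) (drop-mid as [] p)
  ...     | k , k≤ , s | l , l≤ , s′ =
    k + l ,
    +-mono-≤ (≤-trans k≤ (≤-trans (length≤∣∣ {C = C} (Unique.filter⁺ (_∈? C) as-unique) in-C) (size≤ comp v∈C))) l≤ ,
    swaps-++ s (swaps-∷ (head∉tail (unique-resp-↭ (shift v as bs) uniq)) s′)
    where
    as-unique : Unique as
    as-unique = proj₁ (AllPairs-++⁻ as uniq)
      where
      AllPairs-++⁻ : ∀ xs {ys : List (Fin n)} → Unique (xs ++ ys) → Unique xs × Unique ys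
      AllPairs-++⁻ [] u = [] , u
      AllPairs-++⁻ (x ∷ xs) (px ∷ u) = map₁ (Allₚ.++⁻ˡ xs px ∷_) (AllPairs-++⁻ xs u)
    in-C : ∀ {x} → x ∈ₗ filter (_∈? C) as → x ∈ C
    in-C = proj₂ ∘ ∈ₗ.∈-filter⁻ (_∈? C) {xs = as}

-- Sorting bounds the diameter

Represents : ∀ {n} {G : Graph n} → ST G → List (Fin n) → Set
Represents {G = G} T σ = ∀ Z → Z ∈ₗ tubes T ⇔ TubeOf G σ Z

module _ {n : ℕ} {G : Graph n} (con : Connected G) where

  tree-exists : ∀ {σ} → Unique σ → (∀ x → x ∈ₗ σ) → ∃ λ (T : ST G) → Represents T σ
  tree-exists {σ} uniq full with tree-of σ uniq ((λ _ → full _) , con , λ _ _ _ _ _ → ∈⊤)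
  ... | T , spec = T , λ Z → mk⇔ (proj₁ ∘ to (spec Z)) (λ t → from (spec Z) (t , ⊆⊤))

  order-exists : ∀ (T : ST G) → ∃ λ σ → Unique σ × (∀ x → x ∈ₗ σ) × Represents T σ
  order-exists T = L.list , L.unique , (λ _ → L.complete ∈⊤) , λ Z → mk⇔
    (λ Z∈ → subst (λ l → TubeOf G l Z) (++-identityʳ L.list) (L.tube⇐ [] (λ _ ()) (inj₁ Z∈)))
    (λ t → [ id , (λ ()) ]′ (L.tube⇒ [] (λ _ ()) (subst (λ l → TubeOf G l Z) (≡-sym (++-identityʳ L.list)) t)))
    where
    open import Data.List.Properties using (++-identityʳ)
    module L = Linearisation (linearise T con)

  exchange⇒rotation : ∀ {σ σ′} (T T′ : ST G) → Represents T σ → Represents T′ σ′ →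
                      Exchange G σ σ′ → Rotation T T′
  exchange⇒rotation T T′ rep rep′ E =
    E.X , E.Y , (λ X≡Y → E.Y∉σ (subst (TubeOf G _) X≡Y E.X∈σ)) , λ Z → mk⇔
      (λ where
        (inj₁ (Z∈ , Z∉)) → [ inj₁ , (λ t → contradiction (from (rep′ Z) t) Z∉) ]′ (E.⇒ (to (rep Z) Z∈))
        (inj₂ (Z∉ , Z∈)) → [ inj₂ , (λ t → contradiction (from (rep Z) t) Z∉) ]′ (E.⇐ (to (rep′ Z) Z∈)))
      (λ where
        (inj₁ refl) → inj₁ (from (rep Z) E.X∈σ , E.X∉σ′ ∘ to (rep′ Z))
        (inj₂ refl) → inj₂ (E.Y∉σ ∘ to (rep Z) , from (rep′ Z) E.Y∈σ′))
    where module E = Exchange E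

  -- Each `exch` needs an actual intermediate tree, which comes from the intermediate order; across
  -- a `free` step the same tree represents both orders.
  swaps⇒reach : ∀ {k σ τ} → Unique σ → (∀ x → x ∈ₗ σ) → Swaps G k σ τ →
                ∀ (T T′ : ST G) → Represents T σ → Represents T′ τ → Reach k T T′
  swaps⇒reach _ _ done T T′ rep rep′ =
    same λ Z → mk⇔ (from (rep′ Z) ∘ to (rep Z)) (from (rep Z) ∘ to (rep′ Z))
  swaps⇒reach uniq full (free p f g s) T T′ rep rep′ =
    swaps⇒reach (unique-resp-↭ p uniq) (∈-resp-↭ p ∘ full) s T T′
      (λ Z → mk⇔ (f ∘ to (rep Z)) (from (rep Z) ∘ g)) rep′
  swaps⇒reach uniq full (exch p E s) T T′ rep rep′
    with tree-exists (unique-resp-↭ p uniq) (∈-resp-↭ p ∘ full)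
  ... | T₁ , rep₁ = rot (exchange⇒rotation T T₁ rep rep₁ E)
    (swaps⇒reach (unique-resp-↭ p uniq) (∈-resp-↭ p ∘ full) s T₁ T′ rep₁ rep′)

  diameter≤2cost : ∀ {τ c} → Unique τ → (∀ x → x ∈ₗ τ) → Cost G τ c → DiamAtMost G (c + c)
  diameter≤2cost uniq full cost T T′ with order-exists T | order-exists T′
  ... | σ , uσ , fσ , rσ | σ′ , uσ′ , fσ′ , rσ′
    with sort cost uσ (∼bag⇒↭ (unique∧set⇒bag uσ uniq (mk⇔ (λ _ → full _) (λ _ → fσ _))))
       | sort cost uσ′ (∼bag⇒↭ (unique∧set⇒bag uσ′ uniq (mk⇔ (λ _ → full _) (λ _ → fσ′ _))))
  ... | k , k≤c , s | k′ , k′≤c , s′ =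
    k + k′ , +-mono-≤ k≤c k′≤c , swaps⇒reach uσ fσ (swaps-++ s (swaps-sym s′)) T T′ rσ rσ′

-- Clique separators in chordal graphs

least : ∀ {P : ℕ → Set} → Decidable P → ∀ {l} → P l → ∃ λ m → P m × (∀ {i} → i < m → ¬ P i)
least P? {zero} p = 0 , p , λ ()
least {P} P? {suc l} p with P? 0
... | yes p₀ = 0 , p₀ , λ ()
... | no ¬p₀ with least (P? ∘ suc) p
...   | m , pm , min = suc m , pm , below-m
  where
  below-m : ∀ {i} → i < suc m → ¬ P i
  below-m {zero}  _   = ¬p₀
  below-m {suc i} i<m = min (s≤s⁻¹ i<m)

module _ {n : ℕ} {H : Graph n} (D : Subset n) (x : Fin n) where

  -- A walk of `l` edges inside `D` from `u` to a neighbour of `x`; the count thus starts with 0 at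
  -- the neighbours of `x`.
  Near : ℕ → Fin n → Set
  Near zero    u = u ∈ D × Edge H u x
  Near (suc l) u = u ∈ D × ∃ λ w → Edge H u w × Near l w

  near? : ∀ l → Decidable (Near l)
  near? zero    u = u ∈? D ×-dec (adj H u x Bool.≟ true)
  near? (suc l) u = u ∈? D ×-dec any? (λ w → (adj H u w Bool.≟ true) ×-dec near? l w)

  near∈ : ∀ l {u} → Near l u → u ∈ D
  near∈ zero    = proj₁
  near∈ (suc l) = proj₁

  walk⇒near : ∀ {u w} → WalkIn H D u w → Edge H w x → ∃ λ l → Near l u
  walk⇒near (here u∈D)      ex = 0 , u∈D , ex
  walk⇒near (step u∈D e wk) ex with walk⇒near wk ex
  ... | l , near = suc l , u∈D , _ , e , near

  AtDistance : ℕ → Fin n → Set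
  AtDistance l u = Near l u × (∀ {m} → m < l → ¬ Near m u)

  distance-unique : ∀ {i j u} → AtDistance i u → AtDistance j u → i ≡ j
  distance-unique {i} {j} (near , min) (near′ , min′) with <-cmp i j
  ... | tri< i<j _ _ = contradiction near (min′ i<j)
  ... | tri≈ _ i≡j _ = i≡j
  ... | tri> _ _ j<i = contradiction near′ (min j<i)

  distance-edge : ∀ {i j u w} → AtDistance i u → AtDistance j w → Edge H u w → i ≤ suc j
  distance-edge {i} (near , min) (near′ , _) e = ≮⇒≥ λ j<i → min j<i (near∈ i near , _ , e , near′)

  -- Vertices of a geodesic are indexed by their distance, so adjacency and
  -- injectivity along it can be read off from the indices.
  Geodesic : ℕ → (ℕ → Fin n) → Set
  Geodesic l q = (∀ {i} → i ≤ l → AtDistance i (q i)) × (∀ {i} → i < l → Edge H (q i) (q (suc i)))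

  geodesic : ∀ l {u} → AtDistance l u → ∃ λ q → q l ≡ u × Geodesic l q
  geodesic zero {u} at = (λ _ → u) , refl , (λ where z≤n → at) , λ ()
  geodesic (suc l) {u} at@((u∈D , w , e , near) , min)
    with geodesic l {w} (near , λ m<l near′ → min (s≤s m<l) (u∈D , w , e , near′))
  ... | q , refl , ats , edges = q′ , end , ats′ , edges′
    where
    -- Past `l` only the value at `suc l` matters; `Geodesic` says nothing about larger indices.
    q′ : ℕ → Fin n
    q′ i with i ≤? l
    ... | yes _ = q i
    ... | no  _ = u
    end : q′ (suc l) ≡ u
    end with suc l ≤? l
    ... | yes l<l = contradiction l<l (<-irrefl refl)
    ... | no  _   = refl
    ats′ : ∀ {i} → i ≤ suc l → AtDistance i (q′ i)
    ats′ {i} i≤ with i ≤? l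
    ... | yes i≤l = ats i≤l
    ... | no  i≰l with ≤-antisym i≤ (≰⇒> i≰l)
    ...   | refl = at
    edges′ : ∀ {i} → i < suc l → Edge H (q′ i) (q′ (suc i))
    edges′ {i} (s≤s i≤) with i ≤? l | suc i ≤? l
    ... | yes _   | yes i<l = edges i<l
    ... | no  i≰l | _       = contradiction i≤ i≰l
    ... | yes _   | no  i≮l with ≤-antisym i≤ (≮⇒≥ i≮l)
    ...   | refl = edge-sym H e

ListClique : ∀ {n} → Graph n → List (Fin n) → Set
ListClique H K = ∀ {x y} → x ∈ₗ K → y ∈ₗ K → x ≢ y → Edge H x y

module _ {n : ℕ} {H : Graph n} (chordal : Chordal H) where

  -- Otherwise y , x , q 0 , … , q j with j the least index such that q j is adjacent
  -- to y would be a chordless cycle.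
  geodesic-start-adjacent : ∀ {D x y l q} → x ∉ D → y ∉ D → Edge H y x →
    Geodesic {H = H} D x l q → Edge H (q l) y → Edge H (q 0) y
  geodesic-start-adjacent {D} {x} {y} {l} {q} x∉D y∉D yx (ats , edges) ql-y
    with least {λ j → j ≤ l × Edge H (q j) y} (λ j → j ≤? l ×-dec (adj H (q j) y Bool.≟ true)) (≤-refl , ql-y)
  ... | zero  , (_ , q0-y) , _ = q0-y
  ... | suc j , (j<l , qj-y) , min = contradiction chord no-chord
    where
    f : ℕ → Fin n
    f 0             = y
    f 1             = x
    f (suc (suc i)) = q i
    -- The least index is `suc j` here, and `q (suc j)` sits at position `3 + j`. The cycle has
    -- `4 + j` vertices, the form that `Chordal` asks for.
    last = 3 + j
    q∈D : ∀ {i} → i ≤ l → q i ∈ D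
    q∈D {i} i≤l = near∈ D x i (proj₁ (ats i≤l))
    bound : ∀ {i} → 2 + i ≤ last → i ≤ l
    bound i≤ = ≤-trans (s≤s⁻¹ (s≤s⁻¹ i≤)) j<l
    f-apart : ∀ {a b} → a < b → b ≤ last → f a ≢ f b
    f-apart {0} {1} _ _ y≡x = contradiction (trans (≡-sym (subst (λ z → Edge H z x) y≡x yx)) (irref H x)) λ ()
    f-apart {0} {suc (suc i)} _ b≤ y≡q = y∉D (subst (_∈ D) (≡-sym y≡q) (q∈D (bound b≤)))
    f-apart {1} {suc (suc i)} _ b≤ x≡q = x∉D (subst (_∈ D) (≡-sym x≡q) (q∈D (bound b≤)))
    f-apart {1} {1} (s≤s ()) _ _
    f-apart {suc (suc i)} {suc (suc i′)} (s≤s (s≤s i<i′)) b≤ q≡q =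
      <⇒≢ i<i′ (distance-unique D x (subst (AtDistance D x i) q≡q (ats (≤-trans (<⇒≤ i<i′) (bound b≤)))) (ats (bound b≤)))
    -- Chords at `y` contradict the choice of the least index, and chords at `x` the distances, as
    -- only distance 0 is adjacent to `x`; along `q` the distances of adjacent vertices differ by at
    -- most 1.
    f-adjacent : ∀ {a b} → a < b → b ≤ last → Edge H (f a) (f b) → b ≡ suc a ⊎ (a ≡ 0 × suc b ≡ suc last)
    f-adjacent {0} {1} _ _ _ = inj₁ refl
    f-adjacent {0} {suc (suc i)} _ b≤ e = inj₂ (refl , cong (λ m → suc (suc (suc m)))
      (≤-antisym (s≤s⁻¹ (s≤s⁻¹ b≤)) (≮⇒≥ λ i<j → min i<j (bound b≤ , edge-sym H e))))
    f-adjacent {1} {1} (s≤s ()) _ _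
    f-adjacent {1} {suc (suc zero)} _ b≤ e = inj₁ refl
    f-adjacent {1} {suc (suc (suc i))} _ b≤ e =
      contradiction (q∈D (bound b≤) , edge-sym H e) (proj₂ (ats (bound b≤)) (s≤s z≤n))
    f-adjacent {suc (suc i)} {suc (suc i′)} (s≤s (s≤s i<i′)) b≤ e = inj₁ (cong (λ m → suc (suc m))
      (≤-antisym (distance-edge D x (ats (bound b≤)) (ats (≤-trans (<⇒≤ i<i′) (bound b≤))) (edge-sym H e)) i<i′))
    f-next : ∀ {a} → suc a ≤ last → Edge H (f a) (f (suc a))
    f-next {0} _ = yx
    f-next {1} _ = edge-sym H (proj₂ (proj₁ (ats {0} z≤n)))
    f-next {suc (suc a)} a< = edges (≤-trans (s≤s⁻¹ (s≤s⁻¹ a<)) j<l)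
    c : Fin (4 + j) → Fin n
    c = f ∘ toℕ
    ≤last : ∀ (i : Fin (4 + j)) → toℕ i ≤ last
    ≤last i = s≤s⁻¹ (toℕ<n i)
    c-injective : ∀ i i′ → c i ≡ c i′ → i ≡ i′
    c-injective i i′ eq with <-cmp (toℕ i) (toℕ i′)
    ... | tri< lt _ _ = contradiction eq (f-apart lt (≤last i′))
    ... | tri≈ _ eq′ _ = toℕ-injective eq′
    ... | tri> _ _ gt = contradiction (≡-sym eq) (f-apart gt (≤last i))
    next : ∀ i i′ → toℕ i′ ≡ suc (toℕ i) → Edge H (c i) (c i′)
    next i i′ eq = subst (λ m → Edge H (c i) (f m)) (≡-sym eq) (f-next (subst (_≤ last) eq (≤last i′)))
    wrap : ∀ i i′ → toℕ i ≡ 0 → suc (toℕ i′) ≡ 4 + j → Edge H (c i) (c i′)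
    wrap i i′ eq eq′ rewrite eq | suc-injective eq′ = edge-sym H qj-y
    c-edge : ∀ i i′ → CycNeighbours (4 + j) i i′ → Edge H (c i) (c i′)
    c-edge i i′ (inj₁ eq) = next i i′ eq
    c-edge i i′ (inj₂ (inj₁ eq)) = edge-sym H (next i′ i eq)
    c-edge i i′ (inj₂ (inj₂ (inj₁ (eq , eq′)))) = wrap i i′ eq eq′
    c-edge i i′ (inj₂ (inj₂ (inj₂ (eq , eq′)))) = edge-sym H (wrap i′ i eq eq′)
    chord = chordal j c (c-injective , c-edge)
    no-chord : ¬ (Σ (Fin (4 + j)) λ i → Σ (Fin (4 + j)) λ i′ → i ≢ i′ × ¬ CycNeighbours (4 + j) i i′ × Edge H (c i) (c i′))
    no-chord (i , i′ , i≢i′ , not-nbr , e) with <-cmp (toℕ i) (toℕ i′)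
    ... | tri< lt _ _ = not-nbr ([ inj₁ , inj₂ ∘ inj₂ ∘ inj₁ ]′ (f-adjacent lt (≤last i′) e))
    ... | tri≈ _ eq _ = i≢i′ (toℕ-injective eq)
    ... | tri> _ _ gt = not-nbr ([ inj₂ ∘ inj₁ , inj₂ ∘ inj₂ ∘ inj₂ ]′ (f-adjacent gt (≤last i) (edge-sym H e)))

  -- Induction over `K`. From a vertex `v` adjacent to the rest of `K`, a geodesic in `D` leads to a
  -- neighbour `q 0` of the new vertex `x`. Each `y` in the rest is adjacent to both `x` and `v`, so
  -- it is adjacent to `q 0` as well.
  dominating-vertex : ∀ {D} → ConnectedIn H D → ∀ K → Unique K → ListClique H K →
    (∀ {x} → x ∈ₗ K → x ∉ D × ∃ λ u → u ∈ D × Edge H u x) →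
    ∃ λ v → v ∈ D × (∀ {x} → x ∈ₗ K → Edge H v x)
  dominating-vertex ((v , v∈D) , _) [] _ _ _ = v , v∈D , λ ()
  dominating-vertex {D} con@(_ , walks) (x ∷ K) uniq clique nbrs
    with dominating-vertex con K (unique-tail uniq) (λ y∈ z∈ → clique (there y∈) (there z∈)) (nbrs ∘ there)
       | nbrs (here refl)
  ... | v , v∈D , dom | x∉D , u , u∈D , ux
    with least (λ l → near? D x l v) (proj₂ (walk⇒near D x (walks v u v∈D u∈D) ux))
  ... | l , at with geodesic D x l at
  ...   | q , refl , geo@(ats , _) = q 0 , proj₁ (proj₁ (ats z≤n)) , λ where
    (here refl) → proj₂ (proj₁ (ats z≤n))
    (there y∈)  → geodesic-start-adjacent x∉D (proj₁ (nbrs (there y∈)))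
      (clique (there y∈) (here refl) λ where refl → head∉tail uniq y∈) geo (dom y∈)

disjoint-sizes : ∀ {n} (p q r : Subset n) → (∀ {x} → x ∈ p → x ∉ q) →
                 (∀ {x} → x ∈ p → x ∈ r) → (∀ {x} → x ∈ q → x ∈ r) → ∣ p ∣ + ∣ q ∣ ≤ ∣ r ∣
disjoint-sizes [] [] [] _ _ _ = z≤n
disjoint-sizes (s ∷ p) (t ∷ q) (u ∷ r) apart p⊆r q⊆r = heads s t u apart p⊆r q⊆r
  where
  tails : ∣ p ∣ + ∣ q ∣ ≤ ∣ r ∣
  tails = disjoint-sizes p q r (λ x∈p x∈q → apart (there x∈p) (there x∈q))
    (drop-there ∘ p⊆r ∘ there) (drop-there ∘ q⊆r ∘ there)
  heads : ∀ s t u → (∀ {x} → x ∈ s ∷ p → x ∉ t ∷ q) → (∀ {x} → x ∈ s ∷ p → x ∈ u ∷ r) →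
          (∀ {x} → x ∈ t ∷ q → x ∈ u ∷ r) → ∣ s ∷ p ∣ + ∣ t ∷ q ∣ ≤ ∣ u ∷ r ∣
  heads outside outside u _ _ _ = ≤-trans tails (∣p∣≤∣x∷p∣ u r)
  heads inside  inside  _ apart _ _ = contradiction here (apart here)
  heads inside  outside inside _ _ _ = s≤s tails
  heads outside inside  inside _ _ _ = ≤-trans (≤-reflexive (+-suc ∣ p ∣ ∣ q ∣)) (s≤s tails)
  heads inside  outside outside _ p⊆ _ = case p⊆ here of λ ()
  heads outside inside  outside _ _ q⊆ = case q⊆ here of λ ()

_∖_ : ∀ {n} → Subset n → List (Fin n) → Subset n
C ∖ []      = C
C ∖ (x ∷ K) = (C ∖ K) - x

module _ {n : ℕ} {C : Subset n} where

  x∈∖⁺ : ∀ K {x} → x ∈ C → x ∉ₗ K → x ∈ C ∖ K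
  x∈∖⁺ []      x∈C _   = x∈C
  x∈∖⁺ (y ∷ K) x∈C x∉K = x∈p∧x≢y⇒x∈p-y (x∈∖⁺ K x∈C (x∉K ∘ there)) (x∉K ∘ here)

  x∈∖⁻ : ∀ K {x} → x ∈ C ∖ K → x ∈ C × x ∉ₗ K
  x∈∖⁻ []      x∈ = x∈ , λ ()
  x∈∖⁻ (y ∷ K) x∈ with x∈∖⁻ K (x∈p-y⇒x∈p (C ∖ K) x∈)
  ... | x∈C , x∉K = x∈C , λ where
    (here x≡y)  → x∈p-y⇒x≢y (C ∖ K) x∈ x≡y
    (there x∈K) → x∉K x∈K

nonempty⇒0<∣∣ : ∀ {n} {C : Subset n} {v} → v ∈ C → 0 < ∣ C ∣
nonempty⇒0<∣∣ v∈C = ≤-trans (s≤s z≤n) (x∈p⇒∣p-x∣<∣p∣ v∈C)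

module _ {n : ℕ} {H : Graph n} (chordal : Chordal H) (C : Subset n) where

  Rest : List (Fin n) → Fin n → Set
  Rest K x = x ∈ C × x ∉ₗ K

  rest? : ∀ K → Decidable (Rest K)
  rest? K x = x ∈? C ×-dec ¬? (x ∈ₗ? K)

  Balanced : List (Fin n) → Set
  Balanced K = ∀ {D} → ComponentOf H (Rest K) D → ∣ D ∣ + ∣ D ∣ ≤ ∣ C ∣

  Separator : Set
  Separator = ∃ λ K → Unique K × ListClique H K × (∀ {x} → x ∈ₗ K → x ∈ C) × Balanced K

  -- The search runs over vertices and tests the component of each, instead of running over all
  -- subsets.
  balanced-or-big : ∀ K → (∃ λ D → ComponentOf H (Rest K) D × ∣ C ∣ < ∣ D ∣ + ∣ D ∣) ⊎ Balanced K
  balanced-or-big K with any? big-at?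
    where
    big-at? : ∀ v → Dec (∃ λ D → ComponentOf H (Rest K) D × v ∈ D × ∣ C ∣ < ∣ D ∣ + ∣ D ∣)
    big-at? v with rest? K v
    ... | no  v∉ = no λ (D , (D⊆ , _) , v∈D , _) → v∉ (D⊆ v∈D)
    ... | yes v∈ with component H (rest? K) v∈
    ...   | D , comp , v∈D with ∣ C ∣ <? ∣ D ∣ + ∣ D ∣
    ...     | yes big   = yes (D , comp , v∈D , big)
    ...     | no  small = no λ (D′ , comp′ , v∈D′ , big) →
      small (subst (λ E → ∣ C ∣ < ∣ E ∣ + ∣ E ∣) (component-unique comp′ comp v∈D′ v∈D) big)
  ... | yes (v , D , comp , _ , big) = inj₁ (D , comp , big)
  ... | no none = inj₂ λ {D} comp@(_ , ((v , v∈D) , _) , _) → ≮⇒≥ λ big → none (v , D , comp , v∈D , big)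

  -- While some component D is too big, forget the vertices of K that have no neighbour
  -- in D and add a vertex of D that dominates the others; D then shrinks.
  refine : ∀ fuel {K D} → ∣ D ∣ < fuel → Unique K → ListClique H K → (∀ {x} → x ∈ₗ K → x ∈ C) →
           ComponentOf H (Rest K) D → ∣ C ∣ < ∣ D ∣ + ∣ D ∣ → Separator
  refine (suc fuel) {K} {D} D<fuel uniq clique K⊆C (D⊆ , con , closed) big =
    finish (balanced-or-big K₂)
    where
    nbr? : Decidable (λ x → ∃ λ u → u ∈ D × Edge H u x)
    nbr? x = any? λ u → u ∈? D ×-dec (adj H u x Bool.≟ true)
    K₁ = filter nbr? K
    K₁⁻ : ∀ {x} → x ∈ₗ K₁ → x ∈ₗ K × (∃ λ u → u ∈ D × Edge H u x)
    K₁⁻ = ∈ₗ.∈-filter⁻ nbr? {xs = K}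
    clique₁ : ListClique H K₁
    clique₁ x∈ y∈ = clique (proj₁ (K₁⁻ x∈)) (proj₁ (K₁⁻ y∈))
    -- `D` stays a component, because the vertices put back have no neighbour in it.
    D-comp : ComponentOf H (Rest K₁) D
    D-comp = (λ x∈D → map₂ (_∘ proj₁ ∘ K₁⁻) (D⊆ x∈D)) , con , λ u v u∈D (v∈C , v∉K₁) e →
      closed u v u∈D (v∈C , λ v∈K → v∉K₁ (∈ₗ.∈-filter⁺ nbr? v∈K (u , u∈D , e))) e
    dominator = dominating-vertex chordal con K₁ (Unique.filter⁺ nbr? uniq) clique₁
      λ x∈ → (λ x∈D → proj₂ (D⊆ x∈D) (proj₁ (K₁⁻ x∈))) , proj₂ (K₁⁻ x∈)
    v = proj₁ dominator
    v∈D : v ∈ D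
    v∈D = proj₁ (proj₂ dominator)
    dom : ∀ {x} → x ∈ₗ K₁ → Edge H v x
    dom = proj₂ (proj₂ dominator)
    K₂ = v ∷ K₁
    unique₂ : Unique K₂
    unique₂ = unique-∷ (λ v∈ → proj₂ (D⊆ v∈D) (proj₁ (K₁⁻ v∈))) (Unique.filter⁺ nbr? uniq)
    clique₂ : ListClique H K₂
    clique₂ (here refl) (here refl) v≢v = contradiction refl v≢v
    clique₂ (here refl) (there y∈)  _   = dom y∈
    clique₂ (there x∈)  (here refl) _   = edge-sym H (dom x∈)
    clique₂ (there x∈)  (there y∈)      = clique₁ x∈ y∈
    K₂⊆C : ∀ {x} → x ∈ₗ K₂ → x ∈ C
    K₂⊆C (here refl) = proj₁ (D⊆ v∈D)
    K₂⊆C (there x∈)  = K⊆C (proj₁ (K₁⁻ x∈))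
    -- Two disjoint sets in `C`, each larger than half of it, cannot exist. So `E` meets `D`, lies
    -- inside it, and misses `v`.
    smaller : ∀ {E} → ComponentOf H (Rest K₂) E → ∣ C ∣ < ∣ E ∣ + ∣ E ∣ → ∣ E ∣ < ∣ D ∣
    smaller {E} (E⊆ , conE , _) bigE with any? (λ x → x ∈? D ×-dec x ∈? E)
    ... | yes (x , x∈D , x∈E) = p⊂q⇒∣p∣<∣q∣
      (absorb D-comp (map₂ (_∘ there) ∘ E⊆) conE x∈E x∈D , v , v∈D , λ v∈E → proj₂ (E⊆ v∈E) (here refl))
    ... | no disjoint = contradiction
      (+-mono-≤ D+E≤C D+E≤C)
      (<⇒≱ (≤-trans (+-mono-<-≤ big (<⇒≤ bigE)) (≤-reflexive (interchange ∣ D ∣ ∣ E ∣))))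
      where
      D+E≤C : ∣ D ∣ + ∣ E ∣ ≤ ∣ C ∣
      D+E≤C = disjoint-sizes D E C (λ x∈D x∈E → disjoint (_ , x∈D , x∈E)) (proj₁ ∘ D⊆) (proj₁ ∘ E⊆)
      interchange : ∀ a b → (a + a) + (b + b) ≡ (a + b) + (a + b)
      interchange = solve 2 (λ a b → (a :+ a) :+ (b :+ b) := (a :+ b) :+ (a :+ b)) refl
        where open +-*-Solver
    finish : (∃ λ E → ComponentOf H (Rest K₂) E × ∣ C ∣ < ∣ E ∣ + ∣ E ∣) ⊎ Balanced K₂ → Separator
    finish (inj₂ balanced) = K₂ , unique₂ , clique₂ , K₂⊆C , balanced
    finish (inj₁ (E , E-comp , bigE)) =
      refine fuel (≤-trans (smaller E-comp bigE) (s≤s⁻¹ D<fuel)) unique₂ clique₂ K₂⊆C E-comp bigE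

  balanced-separator : Separator
  balanced-separator with balanced-or-big []
  ... | inj₂ balanced         = [] , [] , (λ ()) , (λ ()) , balanced
  ... | inj₁ (D , comp , big) = refine (suc ∣ D ∣) ≤-refl [] (λ ()) (λ ()) comp big

-- Cheap linear orders

module _ {n : ℕ} {G : Graph n} where

  walk-separated : ∀ {P Q S u v} → Separated G P Q → (∀ {x} → x ∈ S → P x ⊎ Q x) →
                   WalkIn G S u v → P u → P v
  walk-separated sep cover (here _) Pu = Pu
  walk-separated sep cover (step _ e w) Pu with cover (walk-source w)
  ... | inj₁ Pw = walk-separated sep cover w Pw
  ... | inj₂ Qw = contradiction e (proj₂ (sep Pu Qw))

  -- No edge leads from `L` to `M`, so the tubes of vertices of `L` are those without `M` appended.
  cost-++ : ∀ {L M a b} → Cost G L a → Cost G M b → Separated G (_∈ₗ L) (_∈ₗ M) → Cost G (L ++ M) (a + b)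
  cost-++ [] cM sep = cM
  cost-++ {v ∷ ys} {M} {b = b} (_∷_ {a = a₁} {b = a₂} size≤ cL) cM sep =
    subst (Cost G _) (≡-sym (+-assoc a₁ a₂ b))
      ((λ comp@(C⊆ , (_ , walks) , _) v∈C → size≤
          (component-restrict ∈ₗ.∈-++⁺ˡ
            (λ x∈C → walk-separated sep (∈ₗ.∈-++⁻ (v ∷ ys) ∘ C⊆) (walks v _ v∈C x∈C) (here refl)) comp) v∈C)
       ∷ cost-++ cL cM (sep ∘ there))

  cost-prepend : ∀ K {L c} {C : Subset n} → Cost G L c → (∀ {x} → x ∈ₗ K ++ L → x ∈ C) →
                 Cost G (K ++ L) (length K * ∣ C ∣ + c)
  cost-prepend [] cL _ = cL
  cost-prepend (x ∷ K) {c = c} {C} cL ⊆C =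
    subst (Cost G _) (≡-sym (+-assoc ∣ C ∣ (length K * ∣ C ∣) c))
      ((λ (D⊆ , _) _ → p⊆q⇒∣p∣≤∣q∣ (⊆C ∘ D⊆)) ∷ cost-prepend K cL (⊆C ∘ there))

-- A tube in `G` is connected in `H` too, hence contained in the tube of the same vertex in `H`.
cost-mono : ∀ {n} {G H : Graph n} {L c} → (∀ u v → Edge G u v → Edge H u v) → Cost H L c → Cost G L c
cost-mono G⊆H [] = []
cost-mono {G = G} {H} G⊆H (_∷_ {v} {ys} size≤ c) =
  (λ (C⊆ , ((z , z∈C) , walks) , _) v∈C → case component H (_∈ₗ? (v ∷ ys)) (here refl) of λ
    (D , comp , v∈D) → ≤-trans
      (p⊆q⇒∣p∣≤∣q∣ (absorb comp C⊆ ((z , z∈C) , λ u w u∈ w∈ → walk-map (walks u w u∈ w∈)) v∈C v∈D))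
      (size≤ comp v∈D))
  ∷ cost-mono G⊆H c
  where
  walk-map : ∀ {S u w} → WalkIn G S u w → WalkIn H S u w
  walk-map (here u∈)     = here u∈
  walk-map (step u∈ e w) = step u∈ (G⊆H _ _ e) (walk-map w)

module _ {n : ℕ} {H : Graph n} (chordal : Chordal H) {w : ℕ}
         (clique≤ : ∀ {K} → Unique K → ListClique H K → length K ≤ w) where

  -- `w * d` is the charge per vertex: at each of `d` levels of the recursion a vertex lies in the
  -- tubes of at most `w` separator vertices.
  CheapOrder : Subset n → ℕ → Set
  CheapOrder S d = ∃ λ L → Unique L × (∀ {x} → x ∈ₗ L → x ∈ S) × (∀ {x} → x ∈ S → x ∈ₗ L) ×
    ∃ λ c → c ≤ ∣ S ∣ * (w * d) × Cost H L c

  -- The separator `K` comes first, then what remains of `C`, then the rest of `S`. The tubes of `K`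
  -- add at most `w * ∣ C ∣`, which raises the charge on `C` from `w * d` to `w * suc d`.
  cheap-order-∪ : ∀ {d S C K} → IsComponent H S C → Unique K → ListClique H K → (∀ {x} → x ∈ₗ K → x ∈ C) →
                  CheapOrder (C ∖ K) d → CheapOrder (S ─ C) (suc d) → CheapOrder S (suc d)
  cheap-order-∪ {d} {S} {C} {K} (C⊆S , _ , closed) uniq clique K⊆C
                (L₁ , u₁ , ⊆₁ , ⊇₁ , c₁ , c₁≤ , cost₁) (L₂ , u₂ , ⊆₂ , ⊇₂ , c₂ , c₂≤ , cost₂) =
    (K ++ L₁) ++ L₂ ,
    Unique.++⁺ (Unique.++⁺ uniq u₁ λ (x∈K , x∈L₁) → proj₂ (x∈∖⁻ K (⊆₁ x∈L₁)) x∈K) u₂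
      (λ (x∈ , x∈L₂) → x∈p─q⇒x∉q S C (⊆₂ x∈L₂) (in-C x∈)) ,
    ([ C⊆S ∘ in-C , p─q⊆p S C ∘ ⊆₂ ]′ ∘ ∈ₗ.∈-++⁻ (K ++ L₁)) , complete ,
    length K * ∣ C ∣ + c₁ + c₂ , total , cost-++ (cost-prepend K cost₁ in-C) cost₂ separated
    where
    in-C : ∀ {x} → x ∈ₗ K ++ L₁ → x ∈ C
    in-C = [ K⊆C , proj₁ ∘ x∈∖⁻ K ∘ ⊆₁ ]′ ∘ ∈ₗ.∈-++⁻ K
    complete : ∀ {x} → x ∈ S → x ∈ₗ (K ++ L₁) ++ L₂
    complete {x} x∈S with x ∈? C | x ∈ₗ? K
    ... | no x∉C  | _       = ∈ₗ.∈-++⁺ʳ (K ++ L₁) (⊇₂ (x∈p∧x∉q⇒x∈p─q x∈S x∉C))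
    ... | yes _   | yes x∈K = ∈ₗ.∈-++⁺ˡ (∈ₗ.∈-++⁺ˡ x∈K)
    ... | yes x∈C | no x∉K  = ∈ₗ.∈-++⁺ˡ (∈ₗ.∈-++⁺ʳ K (⊇₁ (x∈∖⁺ K x∈C x∉K)))
    separated : Separated H (_∈ₗ K ++ L₁) (_∈ₗ L₂)
    separated {u} {x} u∈ x∈ =
      (λ where refl → x∉C (in-C u∈)) , λ e → x∉C (closed u x (in-C u∈) (p─q⊆p S C (⊆₂ x∈)) e)
      where
      x∉C : x ∉ C
      x∉C = x∈p─q⇒x∉q S C (⊆₂ x∈)
    total : length K * ∣ C ∣ + c₁ + c₂ ≤ ∣ S ∣ * (w * suc d)
    total = begin
      length K * ∣ C ∣ + c₁ + c₂
        ≤⟨ +-mono-≤ (+-mono-≤ (*-monoˡ-≤ ∣ C ∣ (clique≤ uniq clique))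
             (≤-trans c₁≤ (*-monoˡ-≤ (w * d) (p⊆q⇒∣p∣≤∣q∣ {p = C ∖ K} {q = C} (proj₁ ∘ x∈∖⁻ K))))) c₂≤ ⟩
      w * ∣ C ∣ + ∣ C ∣ * (w * d) + ∣ S ─ C ∣ * (w * suc d)
        ≡⟨ solve 4 (λ w c d s → w :* c :+ c :* (w :* d) :+ s :* (w :* (con 1 :+ d)) := (c :+ s) :* (w :* (con 1 :+ d)))
             refl w (∣ C ∣) d (∣ S ─ C ∣) ⟩
      (∣ C ∣ + ∣ S ─ C ∣) * (w * suc d)
        ≤⟨ *-monoˡ-≤ (w * suc d) (disjoint-sizes C (S ─ C) S (λ x∈C x∈ → x∈p─q⇒x∉q S C x∈ x∈C) C⊆S (p─q⊆p S C)) ⟩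
      ∣ S ∣ * (w * suc d) ∎
      where
      open ≤-Reasoning
      open +-*-Solver

  -- `d` drops when a component is separated, as component sizes halve; `m` bounds the size of `S`
  -- and drops when one component is split off and the others remain.
  cheap-order : ∀ d m S → ∣ S ∣ ≤ m → (∀ {C} → ComponentOf H (_∈ S) C → ∣ C ∣ < 2 ^ d) → CheapOrder S d
  cheap-order d m S S≤m small with nonempty? S
  cheap-order d m S S≤m small | no empty =
    [] , [] , (λ ()) , (λ x∈S → contradiction (_ , x∈S) empty) , 0 , z≤n , []
  cheap-order d zero S S≤0 small | yes (v , v∈S) = contradiction S≤0 (<⇒≱ (nonempty⇒0<∣∣ v∈S))
  cheap-order zero (suc m) S S≤m small | yes (v , v∈S) =
    let C , comp , v∈C = component H (_∈? S) v∈S in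
    contradiction (small comp) (≤⇒≯ (nonempty⇒0<∣∣ v∈C))
  cheap-order (suc d) (suc m) S S≤m small | yes (v , v∈S) =
    let C , comp@(C⊆S , _ , closed) , v∈C         = component H (_∈? S) v∈S
        K , uniq , clique , K⊆C , balanced = balanced-separator chordal C
    in cheap-order-∪ comp uniq clique K⊆C
      -- Twice the size of a component of `C ∖ K` is at most `∣ C ∣`, which is below `2 ^ suc d`; so
      -- the size is below `2 ^ d`.
      (cheap-order d ∣ C ∖ K ∣ (C ∖ K) ≤-refl λ D-comp → half (≤-trans
        (s≤s (balanced (component-resp (x∈∖⁻ K) (λ (x∈C , x∉K) → x∈∖⁺ K x∈C x∉K) D-comp)))
        (small comp)))
      (cheap-order (suc d) m (S ─ C) (s≤s⁻¹ (≤-trans (p∩q≢∅⇒∣p─q∣<∣p∣ S C (v , x∈p∩q⁺ (v∈S , v∈C))) S≤m))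
        λ (E⊆ , conE , closedE) → small (p─q⊆p S C ∘ E⊆ , conE , λ u x u∈E x∈S e →
          closedE u x u∈E (x∈p∧x∉q⇒x∈p─q x∈S λ x∈C →
            x∈p─q⇒x∉q S C (E⊆ u∈E) (closed x u x∈C (p─q⊆p S C (E⊆ u∈E)) (edge-sym H e))) e))
    where
    half : ∀ {a b} → a + a < b + (b + 0) → a < b
    half {a} {b} a+a<b+b = ≰⇒> λ b≤a → <⇒≱ a+a<b+b
      (+-mono-≤ b≤a (≤-trans (≤-reflexive (+-identityʳ b)) b≤a))

-- The upper bound on the diameter

n<2^[1+⌊log₂n⌋] : ∀ n → n < 2 ^ suc ⌊log₂ n ⌋
n<2^[1+⌊log₂n⌋] n = ≰⇒> λ 2^≤n → <⇒≱ ≤-refl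
  (subst (_≤ ⌊log₂ n ⌋) (⌊log₂[2^n]⌋≡n (suc ⌊log₂ n ⌋)) (⌊log₂⌋-mono-≤ 2^≤n))

-- Separators exist in the chordal supergraph `H`, so the order is built there and its cost is
-- carried over to `G`. The summand occurs twice because both trees are sorted into this order.
diameter-upper-bound : ∀ {n} (G : Graph n) k → Connected G → TreewidthAtMost G k →
  DiamAtMost G (n * (suc k * suc ⌊log₂ n ⌋) + n * (suc k * suc ⌊log₂ n ⌋))
diameter-upper-bound {n} G k con (H , G⊆H , chordal , clique≤)
  with cheap-order {H = H} chordal {suc k} list-clique≤ (suc ⌊log₂ n ⌋) n ⊤ (∣p∣≤n ⊤)
         (λ {C} _ → ≤-trans (s≤s (∣p∣≤n C)) (n<2^[1+⌊log₂n⌋] n))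
  where
  list-clique≤ : ∀ {K} → Unique K → ListClique H K → length K ≤ suc k
  list-clique≤ {K} uniq clique = ≤-trans
    -- The double complement turns the list `K` into a `Subset`, the form in which clique sizes are
    -- bounded.
    (length≤∣∣ {C = ⊤ ─ (⊤ ∖ K)} uniq λ x∈K → x∈p∧x∉q⇒x∈p─q ∈⊤ λ x∈ → proj₂ (x∈∖⁻ K x∈) x∈K)
    (clique≤ _ λ u v u∈ v∈ → clique (in-K u∈) (in-K v∈))
    where
    in-K : ∀ {x} → x ∈ ⊤ ─ (⊤ ∖ K) → x ∈ₗ K
    in-K {x} x∈ with x ∈ₗ? K
    ... | yes x∈K = x∈K
    ... | no  x∉K = contradiction (x∈∖⁺ K ∈⊤ x∉K) (x∈p─q⇒x∉q ⊤ (⊤ ∖ K) x∈)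
... | L , uniq , _ , full , c , c≤ , cost = λ T T′ →
  case diameter≤2cost con uniq (λ _ → full ∈⊤) (cost-mono G⊆H cost) T T′ of λ
    (l , l≤ , reach) → l , ≤-trans l≤ (+-mono-≤ c≤n c≤n) , reach
  where
  c≤n : c ≤ n * (suc k * suc ⌊log₂ n ⌋)
  c≤n = subst (λ s → c ≤ s * (suc k * suc ⌊log₂ n ⌋)) (∣⊤∣≡n n) c≤

-- Orientations of edges by search trees

count-mono : ∀ {A : Set} {P Q : A → Set} (P? : Decidable P) (Q? : Decidable Q) E →
             (∀ {x} → x ∈ₗ E → Q x → P x) → length (filter Q? E) ≤ length (filter P? E)
count-mono P? Q? [] _ = z≤n
count-mono P? Q? (x ∷ E) Q⊆P with count-mono P? Q? E (Q⊆P ∘ there) | Q? x | P? x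
... | rest | no _   | no _   = rest
... | rest | no _   | yes _  = m≤n⇒m≤1+n rest
... | rest | yes _  | yes _  = s≤s rest
... | _    | yes Qx | no ¬Px = contradiction (Q⊆P (here refl) Qx) ¬Px

count-≤1+ : ∀ {A : Set} {P Q : A → Set} (P? : Decidable P) (Q? : Decidable Q) {E} → Unique E →
            (∀ {x y} → x ∈ₗ E → y ∈ₗ E → Q x → ¬ P x → Q y → ¬ P y → x ≡ y) →
            length (filter Q? E) ≤ suc (length (filter P? E))
count-≤1+ P? Q? {[]} _ _ = z≤n
count-≤1+ P? Q? {x ∷ E} uniq one
  with count-≤1+ P? Q? (unique-tail uniq) (λ x∈ y∈ → one (there x∈) (there y∈)) | Q? x | P? x
... | rest | no _   | no _   = rest
... | rest | no _   | yes _  = m≤n⇒m≤1+n rest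
... | rest | yes _  | yes _  = s≤s rest
... | _    | yes Qx | no ¬Px = s≤s (count-mono P? Q? E λ {y} y∈ Qy → case P? y of λ where
  (yes Py) → Py
  (no ¬Py) → contradiction (subst (_∈ₗ E) (≡-sym (one (here refl) (there y∈) Qx ¬Px Qy ¬Py)) y∈) (head∉tail uniq))

data Before {A : Set} : List A → A → A → Set where
  here  : ∀ {a b σ} → b ∈ₗ σ → Before (a ∷ σ) a b
  there : ∀ {x a b σ} → Before σ a b → Before (x ∷ σ) a b

before-++ : ∀ {A : Set} {a b : A} {L M} → a ∈ₗ L → b ∈ₗ M → Before (L ++ M) a b
before-++ {L = _ ∷ L} (here refl) b∈ = here (∈ₗ.∈-++⁺ʳ L b∈)
before-++ (there a∈)              b∈ = there (before-++ a∈ b∈)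

before∈ˡ : ∀ {A : Set} {a b : A} {σ} → Before σ a b → a ∈ₗ σ
before∈ˡ (here _)  = here refl
before∈ˡ (there p) = there (before∈ˡ p)

before∈ʳ : ∀ {A : Set} {a b : A} {σ} → Before σ a b → b ∈ₗ σ
before∈ʳ (here b∈) = there b∈
before∈ʳ (there p) = there (before∈ʳ p)

before-total : ∀ {A : Set} {a b : A} {σ} → a ∈ₗ σ → b ∈ₗ σ → a ≢ b → Before σ a b ⊎ Before σ b a
before-total (here refl) (here refl) a≢a = contradiction refl a≢a
before-total (here refl) (there b∈)  _   = inj₁ (here b∈)
before-total (there a∈)  (here refl) _   = inj₂ (here a∈)
before-total (there a∈)  (there b∈)  a≢b = Sum.map there there (before-total a∈ b∈ a≢b)

module _ {n : ℕ} {G : Graph n} where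

  before⇒∉tube : ∀ {σ a b Z} → Unique σ → Before σ a b → Tube G σ b Z → a ∉ Z
  before⇒∉tube u (here b∈)  (top _ _) _   = head∉tail u b∈
  before⇒∉tube u (here _)   (below t) a∈Z = head∉tail u (tube-⊆ t a∈Z)
  before⇒∉tube u (there p)  (top _ _) _   = head∉tail u (before∈ʳ p)
  before⇒∉tube u (there p)  (below t)     = before⇒∉tube (unique-tail u) p t

  -- The root of the tube comes no later than `b`, so `a`, which comes after `b`, is still present,
  -- and the tube is closed under the edge.
  edge-in-tube : ∀ {σ a b w Z} → Unique σ → Before σ b a → Edge G b a → Tube G σ w Z → b ∈ Z → a ∈ Z
  edge-in-tube u p         e (top (_ , _ , closed) _) b∈Z = closed _ _ b∈Z (before∈ʳ p) e
  edge-in-tube u (here _)  e (below t) b∈Z = contradiction (tube-⊆ t b∈Z) (head∉tail u)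
  edge-in-tube u (there p) e (below t) b∈Z = edge-in-tube (unique-tail u) p e t b∈Z

  -- For adjacent vertices this says that b is an ancestor of a.
  Above : ST G → Fin n × Fin n → Set
  Above T (a , b) = Any (λ Z → a ∈ Z × b ∉ Z) (tubes T)

  above? : ∀ T → Decidable (Above T)
  above? T (a , b) = Any.any? (λ Z → a ∈? Z ×-dec ¬? (b ∈? Z)) (tubes T)

  module _ {T : ST G} {σ} (uniq : Unique σ) (rep : Represents T σ) where

    above⇒before : (∀ x → x ∈ₗ σ) → ∀ {a b} → Edge G a b → Above T (a , b) → Before σ b a
    above⇒before full {a} {b} e above with find above
    ... | Z , Z∈ , a∈Z , b∉Z with before-total (full a) (full b) (λ where refl → b∉Z a∈Z)
    ...   | inj₁ a<b = contradiction (edge-in-tube uniq a<b e (proj₂ (to (rep Z) Z∈)) a∈Z) b∉Z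
    ...   | inj₂ b<a = b<a

    before⇒above : ∀ {a b} → Before σ b a → Above T (a , b)
    before⇒above b<a with tube-exists {G = G} (before∈ʳ b<a)
    ... | Z , t = lose (from (rep Z) (_ , t)) (tube-root t , before⇒∉tube uniq b<a t)

    before⇒¬above : ∀ {a b} → Edge G a b → Before σ a b → ¬ Above T (a , b)
    before⇒¬above e a<b above with find above
    ... | Z , Z∈ , a∈Z , b∉Z = b∉Z (edge-in-tube uniq a<b e (proj₂ (to (rep Z) Z∈)) a∈Z)

  -- The tube of `b` in `σ` contains `b` without `a`; with `b` before `a` in `σ′`, a tube of `T′`
  -- that contains `b` contains `a`.
  lost-tube : ∀ {T T′ : ST G} {σ σ′ a b} → Unique σ → Unique σ′ → Represents T σ → Represents T′ σ′ →
              Edge G a b → Before σ a b → Before σ′ b a →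
              ∃ λ Z → Tube G σ b Z × Z ∈ₗ tubes T × ¬ (Z ∈ₗ tubes T′)
  lost-tube u u′ rep rep′ e a<b b<a with tube-exists {G = G} (before∈ʳ a<b)
  ... | Z , t = Z , t , from (rep Z) (_ , t) , λ Z∈ → before⇒∉tube u a<b t
    (edge-in-tube u′ b<a (edge-sym G e) (proj₂ (to (rep′ Z) Z∈)) (tube-root t))

  -- An edge flipped by a rotation has as its endpoints the roots of the two exchanged tubes.
  flip-unique : ∀ {T T′ : ST G} → Connected G → Rotation T T′ → ∀ {p q} →
    Edge G (proj₁ p) (proj₂ p) → Edge G (proj₁ q) (proj₂ q) →
    Above T′ p → ¬ Above T p → Above T′ q → ¬ Above T q → p ≡ q
  flip-unique {T} {T′} con (X , Y , _ , iff) {a , b} {a′ , b′} e e′ up ¬up up′ ¬up′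
    with order-exists con T | order-exists con T′
  ... | σ , u , full , rep | σ′ , u′ , full′ , rep′ =
    cong₂ _,_
      (tube-root-unique u′ Wt (subst (Tube G σ′ _) (≡-sym (pinch W∈ W′∈ Z∈ (distinct Z∈T W∉T) (distinct Z∈T W′∉T))) W′t))
      (tube-root-unique u Zt (subst (Tube G σ _) (≡-sym (pinch Z∈ Z′∈ W∈ (distinct Z∈T W∉T ∘ ≡-sym) (distinct Z′∈T W∉T ∘ ≡-sym))) Z′t))
    where
    before : ∀ {a b} → Edge G a b → ¬ Above T (a , b) → Before σ a b
    before {a} {b} e ¬up = [ id , (λ b<a → contradiction (before⇒above u rep b<a) ¬up) ]′
      (before-total (full a) (full b) λ where refl → contradiction (trans (≡-sym e) (irref G a)) λ ())
    lost : ∀ {a b} → Edge G a b → Above T′ (a , b) → ¬ Above T (a , b) →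
           ∃ λ Z → Tube G σ b Z × Z ∈ₗ tubes T × ¬ (Z ∈ₗ tubes T′)
    lost e up ¬up = lost-tube u u′ rep rep′ e (before e ¬up) (above⇒before u′ rep′ full′ e up)
    gained : ∀ {a b} → Edge G a b → Above T′ (a , b) → ¬ Above T (a , b) →
             ∃ λ W → Tube G σ′ a W × W ∈ₗ tubes T′ × ¬ (W ∈ₗ tubes T)
    gained e up ¬up = lost-tube u′ u rep′ rep (edge-sym G e) (above⇒before u′ rep′ full′ e up) (before e ¬up)
    distinct : ∀ {Z W} → Z ∈ₗ tubes T → ¬ (W ∈ₗ tubes T) → Z ≢ W
    distinct Z∈T W∉T refl = W∉T Z∈T
    -- Lost tubes belong to `T` and gained ones do not. As only `X` and `Y` are available, the two
    -- lost tubes coincide, and so do the two gained ones.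
    pinch : ∀ {A B C : Subset n} → A ≡ X ⊎ A ≡ Y → B ≡ X ⊎ B ≡ Y → C ≡ X ⊎ C ≡ Y → C ≢ A → C ≢ B → A ≡ B
    pinch (inj₁ refl) (inj₁ refl) _ _ _ = refl
    pinch (inj₂ refl) (inj₂ refl) _ _ _ = refl
    pinch (inj₁ refl) (inj₂ refl) (inj₁ refl) C≢A _ = contradiction refl C≢A
    pinch (inj₁ refl) (inj₂ refl) (inj₂ refl) _ C≢B = contradiction refl C≢B
    pinch (inj₂ refl) (inj₁ refl) (inj₁ refl) _ C≢B = contradiction refl C≢B
    pinch (inj₂ refl) (inj₁ refl) (inj₂ refl) C≢A _ = contradiction refl C≢A
    Zs  = lost e up ¬up
    Zs′ = lost e′ up′ ¬up′
    Ws  = gained e up ¬up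
    Ws′ = gained e′ up′ ¬up′
    Zt   = proj₁ (proj₂ Zs)
    Z′t  = proj₁ (proj₂ Zs′)
    Wt   = proj₁ (proj₂ Ws)
    W′t  = proj₁ (proj₂ Ws′)
    Z∈T  = proj₁ (proj₂ (proj₂ Zs))
    Z′∈T = proj₁ (proj₂ (proj₂ Zs′))
    W∉T  = proj₂ (proj₂ (proj₂ Ws))
    W′∉T = proj₂ (proj₂ (proj₂ Ws′))
    Z∈ = to (iff _) (inj₁ (proj₂ (proj₂ Zs)))
    Z′∈ = to (iff _) (inj₁ (proj₂ (proj₂ Zs′)))
    W∈ = to (iff _) (inj₂ (W∉T , proj₁ (proj₂ (proj₂ Ws))))
    W′∈ = to (iff _) (inj₂ (W′∉T , proj₁ (proj₂ (proj₂ Ws′))))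

  module _ {E : List (Fin n × Fin n)} (con : Connected G) (uniq : Unique E)
           (edges : ∀ {p} → p ∈ₗ E → Edge G (proj₁ p) (proj₂ p)) where

    -- By `flip-unique`, one rotation brings at most one new edge of `E` into the count.
    reach-count : ∀ {k} {T T′ : ST G} → Reach k T T′ →
      length (filter (above? T′) E) ≤ k + length (filter (above? T) E)
    reach-count {T = T} {T′} (same iff) = count-mono (above? T) (above? T′) E λ _ above →
      let Z , Z∈ , Z-splits = find above in lose (from (iff Z) Z∈) Z-splits
    reach-count {suc k} {T} (rot {T₁ = T₁} r reach) = ≤-trans (reach-count reach) (≤-trans
      (+-monoʳ-≤ k (count-≤1+ (above? T) (above? T₁) uniq λ x∈ y∈ → flip-unique con r (edges x∈) (edges y∈)))
      (≤-reflexive (+-suc k _)))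

    -- The count is 0 for the tree of `σ` and `length E` for that of `σ′`.
    reversal-lower-bound : ∀ {σ σ′} → Unique σ → (∀ x → x ∈ₗ σ) → Unique σ′ → (∀ x → x ∈ₗ σ′) →
      (∀ {p} → p ∈ₗ E → Before σ (proj₁ p) (proj₂ p)) → (∀ {p} → p ∈ₗ E → Before σ′ (proj₂ p) (proj₁ p)) →
      DiamAtLeast G (length E)
    reversal-lower-bound u full u′ full′ before before′
      with tree-exists con u full | tree-exists con u′ full′
    ... | T , rep | T′ , rep′ = T , T′ , λ k reach → begin
      length E                             ≡⟨ cong length (filter-all (above? T′)
                                                (All.tabulate λ p∈ → before⇒above u′ rep′ (before′ p∈))) ⟨
      length (filter (above? T′) E)        ≤⟨ reach-count reach ⟩
      k + length (filter (above? T) E)     ≡⟨ cong (λ l → k + length l) (filter-none (above? T)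
                                                (All.tabulate λ p∈ → before⇒¬above u rep (edges p∈) (before p∈))) ⟩
      k + 0                                ≡⟨ +-identityʳ k ⟩
      k                                    ∎
      where
      open ≤-Reasoning
      open import Data.List.Properties using (filter-all; filter-none)

-- The join of a clique on h vertices with r independent vertices

module _ (h r : ℕ) where

  inClique : Fin (h + r) → Bool
  inClique u = [ (λ _ → true) , (λ _ → false) ]′ (splitAt h u)

  splitGraph : Graph (h + r)
  splitGraph = record
    { adj   = λ u v → not (Dec.does (u Fin.≟ v)) ∧ (inClique u ∨ inClique v)
    ; sym   = symmetric
    ; irref = irreflexive
    }
    where
    symmetric : ∀ u v → not (Dec.does (u Fin.≟ v)) ∧ (inClique u ∨ inClique v) ≡
                        not (Dec.does (v Fin.≟ u)) ∧ (inClique v ∨ inClique u)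
    symmetric u v with u Fin.≟ v | v Fin.≟ u
    ... | yes _   | yes _   = refl
    ... | no _    | no _    = ∨-comm (inClique u) (inClique v)
    ... | yes u≡v | no v≢u  = contradiction (≡-sym u≡v) v≢u
    ... | no u≢v  | yes v≡u = contradiction (≡-sym v≡u) u≢v
    irreflexive : ∀ u → not (Dec.does (u Fin.≟ u)) ∧ (inClique u ∨ inClique u) ≡ false
    irreflexive u with u Fin.≟ u
    ... | yes _  = refl
    ... | no u≢u = contradiction refl u≢u

  split-edge : ∀ {u v} → u ≢ v → inClique u ≡ true ⊎ inClique v ≡ true → Edge splitGraph u v
  split-edge {u} {v} u≢v q with u Fin.≟ v
  ... | yes u≡v = contradiction u≡v u≢v
  split-edge {u} {v} u≢v (inj₁ q) | no _ rewrite q = refl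
  split-edge {u} {v} u≢v (inj₂ q) | no _ rewrite q = ∨-zeroʳ (inClique u)

  split-edge⁻ : ∀ {u v} → Edge splitGraph u v → inClique u ≡ true ⊎ inClique v ≡ true
  split-edge⁻ {u} {v} e with u Fin.≟ v
  ... | yes _ = case e of λ ()
  ... | no _ with inClique u
  ...   | true  = inj₁ refl
  ...   | false = inj₂ e

  left-inClique : ∀ i → inClique (i ↑ˡ r) ≡ true
  left-inClique i = cong [ _ , _ ]′ (Fin.splitAt-↑ˡ h i r)

  right-notInClique : ∀ i → inClique (h ↑ʳ i) ≡ false
  right-notInClique i = cong [ _ , _ ]′ (Fin.splitAt-↑ʳ h r i)

  -- Of two consecutive vertices of a cycle one is in the clique, hence adjacent to all others:
  -- either position 0, with a chord to 2, or position 1, with a chord to 3.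
  splitGraph-chordal : Chordal splitGraph
  splitGraph-chordal k c (injective , edges) with inClique (c zero) in eq
  ... | true = zero , suc (suc zero) , (λ ()) , (λ where
        (inj₁ ())
        (inj₂ (inj₁ ()))
        (inj₂ (inj₂ (inj₁ (_ , ()))))
        (inj₂ (inj₂ (inj₂ (() , _))))) ,
      split-edge (λ c≡c → case injective _ _ c≡c of λ ()) (inj₁ eq)
  ... | false = suc zero , suc (suc (suc zero)) , (λ ()) , (λ where
        (inj₁ ())
        (inj₂ (inj₁ ()))
        (inj₂ (inj₂ (inj₁ (() , _))))
        (inj₂ (inj₂ (inj₂ (() , _))))) ,
      split-edge (λ c≡c → case injective _ _ c≡c of λ ())
        ([ (λ q → contradiction (trans (≡-sym eq) q) λ ()) , inj₁ ]′
          (split-edge⁻ (edges zero (suc zero) (inj₁ refl))))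

  -- Two independent vertices are never adjacent, so a clique holds at most one of them besides the
  -- `h` clique vertices.
  splitGraph-clique≤ : ∀ S → IsClique splitGraph S → ∣ S ∣ ≤ suc h
  splitGraph-clique≤ S clique = at-most-one-right h S λ i j i∈ j∈ → case i Fin.≟ j of λ where
      (yes i≡j) → i≡j
      (no  i≢j) → contradiction
        (split-edge⁻ (clique _ _ i∈ j∈ (i≢j ∘ Fin.↑ʳ-injective h i j)))
        [ notInClique i , notInClique j ]′
    where
    notInClique : ∀ i → inClique (h ↑ʳ i) ≢ true
    notInClique i q = contradiction (trans (≡-sym (right-notInClique i)) q) λ ()
    at-most-one-right : ∀ h {r} (S : Subset (h + r)) →
      (∀ i j → h ↑ʳ i ∈ S → h ↑ʳ j ∈ S → i ≡ j) → ∣ S ∣ ≤ suc h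
    at-most-one-right zero {r} S one with nonempty? S
    ... | no empty = ≤-trans (≤-reflexive (trans (cong ∣_∣ (Empty-unique empty)) (∣⊥∣≡0 r))) z≤n
    ... | yes (x , x∈S) = ≤-trans
      (p⊆q⇒∣p∣≤∣q∣ λ y∈S → subst (_∈ ⁅ x ⁆) (one _ _ x∈S y∈S) (x∈⁅x⁆ x)) (≤-reflexive (∣⁅x⁆∣≡1 x))
    at-most-one-right (suc h) (inside ∷ S) one =
      s≤s (at-most-one-right h S λ i j i∈ j∈ → one i j (there i∈) (there j∈))
    at-most-one-right (suc h) (outside ∷ S) one =
      m≤n⇒m≤1+n (at-most-one-right h S λ i j i∈ j∈ → one i j (there i∈) (there j∈))

  lefts rights : List (Fin (h + r))
  lefts  = map (_↑ˡ r) (allFin h)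
  rights = map (h ↑ʳ_) (allFin r)

  lefts-unique : Unique lefts
  lefts-unique = Unique.map⁺ (Fin.↑ˡ-injective r _ _) (Unique.allFin⁺ h)

  rights-unique : Unique rights
  rights-unique = Unique.map⁺ (Fin.↑ʳ-injective h _ _) (Unique.allFin⁺ r)

  left∈ : ∀ {x} → x ∈ₗ lefts → inClique x ≡ true
  left∈ x∈ with ∈ₗ.∈-map⁻ (_↑ˡ r) x∈
  ... | i , _ , refl = left-inClique i

  right∈ : ∀ {x} → x ∈ₗ rights → inClique x ≡ false
  right∈ x∈ with ∈ₗ.∈-map⁻ (h ↑ʳ_) x∈
  ... | i , _ , refl = right-notInClique i

  left-or-right : ∀ x → x ∈ₗ lefts ⊎ x ∈ₗ rights
  left-or-right x with splitAt h x in eq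
  ... | inj₁ i = inj₁ (subst (_∈ₗ lefts) (Fin.splitAt⁻¹-↑ˡ eq) (∈ₗ.∈-map⁺ (_↑ˡ r) (∈ₗ.∈-allFin i)))
  ... | inj₂ i = inj₂ (subst (_∈ₗ rights) (Fin.splitAt⁻¹-↑ʳ eq) (∈ₗ.∈-map⁺ (h ↑ʳ_) (∈ₗ.∈-allFin i)))

  splitGraph-connected : 1 ≤ h → Connected splitGraph
  splitGraph-connected (s≤s _) = connected-from {c = zero} ∈⊤ λ {v} _ → case zero Fin.≟ v of λ where
    (yes refl) → here ∈⊤
    (no  0≢v)  → step ∈⊤ (split-edge 0≢v (inj₁ refl)) (here ∈⊤)

  -- Listing the clique first or last reverses all `h * r` edges between it and the independent
  -- vertices.
  splitGraph-diameter : 1 ≤ h → DiamAtLeast splitGraph (h * r)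
  splitGraph-diameter 1≤h = subst (DiamAtLeast splitGraph) size
    (reversal-lower-bound (splitGraph-connected 1≤h) (Unique.cartesianProduct⁺ lefts-unique rights-unique) edges
      (Unique.++⁺ lefts-unique rights-unique apart)
      (λ x → [ ∈ₗ.∈-++⁺ˡ , ∈ₗ.∈-++⁺ʳ lefts ]′ (left-or-right x))
      (Unique.++⁺ rights-unique lefts-unique λ (x∈r , x∈l) → apart (x∈l , x∈r))
      (λ x → [ ∈ₗ.∈-++⁺ʳ rights , ∈ₗ.∈-++⁺ˡ ]′ (left-or-right x))
      (λ p∈ → let l , r = ∈ₗ.∈-cartesianProduct⁻ lefts rights p∈ in before-++ l r)
      (λ p∈ → let l , r = ∈ₗ.∈-cartesianProduct⁻ lefts rights p∈ in before-++ r l))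
    where
    open import Data.List.Properties using (length-map; length-tabulate; length-++)
    apart : ∀ {x} → ¬ (x ∈ₗ lefts × x ∈ₗ rights)
    apart (x∈l , x∈r) = contradiction (trans (≡-sym (left∈ x∈l)) (right∈ x∈r)) λ ()
    edges : ∀ {p} → p ∈ₗ cartesianProduct lefts rights → Edge splitGraph (proj₁ p) (proj₂ p)
    edges p∈ = let l , r = ∈ₗ.∈-cartesianProduct⁻ lefts rights p∈ in
      split-edge (λ where refl → apart (l , r)) (inj₁ (left∈ l))
    length-product : ∀ {A B : Set} (xs : List A) (ys : List B) →
                     length (cartesianProduct xs ys) ≡ length xs * length ys
    length-product []       ys = refl
    length-product (x ∷ xs) ys = trans (length-++ (map (x ,_) ys))
      (cong₂ _+_ (length-map (x ,_) ys) (length-product xs ys))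
    length-lefts : length lefts ≡ h
    length-lefts = trans (length-map (_↑ˡ r) (allFin h)) (length-tabulate {n = h} id)
    length-rights : length rights ≡ r
    length-rights = trans (length-map (h ↑ʳ_) (allFin r)) (length-tabulate {n = r} id)
    size : length (cartesianProduct lefts rights) ≡ h * r
    size = trans (length-product lefts rights) (cong₂ _*_ length-lefts length-rights)

-- Parameters and constants

lower-bound : ∀ {n k h r} → n ≡ h + r → 1 ≤ h → h ≤ k → k ≤ h + h → h ≤ r →
  Σ (Graph n) λ G → Σ ℕ λ d → Connected G × TreewidthAtMost G k × DiamAtLeast G d × k * n ≤ 4 * d
lower-bound {k = k} {h} {r} refl 1≤h h≤k k≤2h h≤r =
  splitGraph h r , h * r , splitGraph-connected h r 1≤h ,
  (splitGraph h r , (λ _ _ → id) , splitGraph-chordal h r , λ S cl → ≤-trans (splitGraph-clique≤ h r S cl) (s≤s h≤k)) ,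
  splitGraph-diameter h r 1≤h , (begin
    -- The constant 4 comes from two factors of 2: `k` is at most `h + h`, and `h + r` is at most
    -- `r + r`.
    k * (h + r)        ≤⟨ *-mono-≤ k≤2h (+-monoˡ-≤ r h≤r) ⟩
    (h + h) * (r + r)  ≡⟨ solve 2 (λ h r → (h :+ h) :* (r :+ r) := con 4 :* (h :* r)) refl h r ⟩
    4 * (h * r)        ∎)
  where
  open ≤-Reasoning
  open +-*-Solver

-- Since `k` and `l` are positive, `suc k` and `suc l` are at most `k + k` and `l + l`; with the two
-- equal summands this makes three factors of 2.
upper-arithmetic : ∀ n {k l} → 1 ≤ k → 1 ≤ l → n * (suc k * suc l) + n * (suc k * suc l) ≤ 8 * k * n * l
upper-arithmetic n {k} {l} 1≤k 1≤l = begin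
  n * (suc k * suc l) + n * (suc k * suc l)          ≤⟨ +-mono-≤ twice twice ⟩
  n * ((k + k) * (l + l)) + n * ((k + k) * (l + l))  ≡⟨ solve 3 (λ n k l →
      n :* ((k :+ k) :* (l :+ l)) :+ n :* ((k :+ k) :* (l :+ l)) := con 8 :* k :* n :* l) refl n k l ⟩
  8 * k * n * l                                      ∎
  where
  open ≤-Reasoning
  open +-*-Solver
  twice : n * (suc k * suc l) ≤ n * ((k + k) * (l + l))
  twice = *-monoʳ-≤ n (*-mono-≤ (+-monoˡ-≤ k 1≤k) (+-monoˡ-≤ l 1≤l))

theorem5 : (tw : ℕ → ℕ) → (∀ n → 2 ≤ n → 1 ≤ tw n × tw n < n) →
    Σ ℕ λ c₁ → Σ ℕ λ c₂ → Σ ℕ λ N → ∀ n → N ≤ n →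
    (Σ (Graph n) λ G → Σ ℕ λ d →
    Connected G × TreewidthAtMost G (tw n) × DiamAtLeast G d × tw n * n ≤ c₁ * d)
    × (∀ (G : Graph n) → Connected G → TreewidthAtMost G (tw n) →
    DiamAtMost G (c₂ * tw n * n * ⌊log₂ n ⌋))
-- From 2 on, both `tw n` and the logarithm are at least 1, as `upper-arithmetic` requires.
theorem5 tw tw-bounds = 4 , 8 , 2 , λ n 2≤n →
  let 1≤k , k<n = tw-bounds n 2≤n
      k = tw n
      h = ⌈ k /2⌉
      -- `⌈ k /2⌉` is by definition `⌊ suc k /2⌋`, so `h + h` is at most `suc k`, hence at most `n`.
      -- This gives `h ≤ r` for `r = n ∸ h`.
      2h≤n : h + h ≤ n
      2h≤n = ≤-trans (+-monoʳ-≤ h (⌊n/2⌋≤⌈n/2⌉ (suc k))) (≤-trans (≤-reflexive (⌊n/2⌋+⌈n/2⌉≡n (suc k))) k<n)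
  in lower-bound {k = k} {h = h} (≡-sym (m+[n∸m]≡n (≤-trans (m≤m+n h h) 2h≤n)))
       (⌈n/2⌉-mono 1≤k) (⌈n/2⌉≤n k)
       (≤-trans (≤-reflexive (≡-sym (⌊n/2⌋+⌈n/2⌉≡n k))) (+-monoˡ-≤ h (⌊n/2⌋≤⌈n/2⌉ k)))
       (m+n≤o⇒m≤o∸n h 2h≤n) ,
     λ G con treewidth T T′ →
       let l , l≤ , reach = diameter-upper-bound G k con treewidth T T′
       in l , ≤-trans l≤ (upper-arithmetic n 1≤k (⌊log₂⌋-mono-≤ 2≤n)) , reach
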